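{- Let $a_0,b_0,c_0,a_1,b_1,c_1\in\mathbb{R}$ with $a_0b_1-a_1b_0\neq0$, let $F_I(x,y)=(a_0x+b_0y+c_0)(a_1x+b_1y+c_1)$ on $\mathbb{Z}^2$, and suppose that divided cells exist for $F_I$. Then every lattice point that is minimal for the extended partial order is a vertex of a divided cell.
   Context: Viewing coordinates: $\Phi(x,y)=(\xi,\eta)=(a_0x+b_0y+c_0,\ a_1x+b_1y+c_1)$; lattice points are the elements of $\Phi(\mathbb{Z}^2)$, and $F_I=\xi\eta$. The axes are $\xi=0$ and $\eta=0$; quadrants are closed quadrants of the $(\xi,\eta)$-plane. A cell is a parallelogram with vertices $P,P+u,P+v,P+u+v$ with $P$ a lattice point and $u,v$ a basis of the lattice of differences of lattice points; it is divided if it has one vertex in each quadrant. Basic partial order: for lattice points $P,Q$ lying in the same quadrant, $P\le Q$ if $|\xi(P)|\le|\xi(Q)|$ and $|\eta(P)|\le|\eta(Q)|$. Lattice lines are lines containing at least two lattice points. If a lattice line meets a quadrant in a bounded interval, then $|\xi\eta|$ restricted to that interval vanishes at its endpoints and has a unique interior maximum point $M$; in that case one additionally declares $P\le Q$ for lattice points $P,Q$ on that interval lying on the same side of $M$ with $Q$ farther from $M$ than $P$. The extended partial order is the transitive closure of the basic partial order together with all these additional relations, over all lattice lines and all quadrants. A lattice point $P$ is minimal if there is no lattice point $Q\neq P$ with $Q\le P$.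
   Formalization: The additional relation is reversed: for P, Q on the same side of M (M counted on both sides), the point farther from M is the smaller one; as printed the order has cycles and the claim fails for (4x+y+3/2)(y+1/2) at (x,y)=(-1,1). -}

module Defs where

open import Algebra.Bundles using (CommutativeRing)
import Algebra.Definitions.RawMonoid as RawMonoidDefinitions
open import Data.Bool.Base using (Bool; true; false)
open import Data.Integer.Base using (ℤ; +_; -[1+_])
open import Data.Nat.Base using (ℕ; suc)
open import Data.Product.Base using (∃; ∃-syntax; _×_; _,_; proj₁; proj₂)
open import Data.Sign.Base as Sign using (Sign)
open import Function.Bundles using (_↔_; Inverse)
open import Level using (Level; _⊔_) renaming (suc to lsuc)
open import Relation.Binary.Construct.Closure.Transitive using (TransClosure)
import Relation.Binary.Construct.StrictToNonStrict as StrictToNonStrict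
open import Relation.Binary.Construct.Union using (_∪_)
open import Relation.Binary.Core using (Rel)
open import Relation.Binary.Definitions using (tri<; tri≈; tri>)
open import Relation.Binary.PropositionalEquality.Core using (_≡_)
open import Relation.Binary.Structures using (IsStrictTotalOrder)
open import Relation.Nullary.Negation.Core using (¬_)
open import Relation.Unary using (Pred)

-- The real numbers, axiomatised as a Dedekind-complete ordered field.
-- These axioms determine the field up to unique isomorphism.  The reals meant
-- here are the classical ones: suprema are approximated by elements of the
-- set, which together with trichotomy yields excluded middle.

record RealField (c ℓ₁ ℓ₂ : Level) : Set (lsuc (c ⊔ ℓ₁ ⊔ ℓ₂)) where
  field
    commutativeRing : CommutativeRing c ℓ₁

  open CommutativeRing commutativeRing public

  infix 4 _<_

  field
    _<_                : Rel Carrier ℓ₂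
    isStrictTotalOrder : IsStrictTotalOrder _≈_ _<_

  infix 4 _≤_

  _≤_ : Rel Carrier (ℓ₁ ⊔ ℓ₂)
  _≤_ = StrictToNonStrict._≤_ _≈_ _<_

  IsUpperBound : ∀ {p} → Pred Carrier p → Pred Carrier (c ⊔ ℓ₁ ⊔ ℓ₂ ⊔ p)
  IsUpperBound S b = ∀ x → S x → x ≤ b

  IsSupremum : ∀ {p} → Pred Carrier p → Pred Carrier (c ⊔ ℓ₁ ⊔ ℓ₂ ⊔ p)
  IsSupremum S s = IsUpperBound S s × (∀ b → b < s → ∃[ x ] (S x × b < x))

  field
    0<1        : 0# < 1#
    +-monoˡ-<  : ∀ {x y} z → x < y → x + z < y + z
    *-positive : ∀ {x y} → 0# < x → 0# < y → 0# < x * y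
    inverse    : ∀ x → ¬ x ≈ 0# → ∃[ y ] x * y ≈ 1#
    complete   : (S : Pred Carrier (c ⊔ ℓ₁ ⊔ ℓ₂)) →
                 ∃ S → ∃ (IsUpperBound S) → ∃ (IsSupremum S)

  ∣_∣ : Carrier → Carrier
  ∣ x ∣ with IsStrictTotalOrder.compare isStrictTotalOrder x 0#
  ... | tri< _ _ _ = - x
  ... | tri≈ _ _ _ = x
  ... | tri> _ _ _ = x

  fromℕ : ℕ → Carrier
  fromℕ n = RawMonoidDefinitions._×_ +-rawMonoid n 1#

  fromℤ : ℤ → Carrier
  fromℤ (+ n)    = fromℕ n
  fromℤ -[1+ n ] = - fromℕ (suc n)

-- Points are given by their viewing coordinates (ξ , η).

module ViewingPlane
  {c ℓ₁ ℓ₂ : Level} (ℝ : RealField c ℓ₁ ℓ₂)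
  (a₀ b₀ c₀ a₁ b₁ c₁ : RealField.Carrier ℝ) where

  open RealField ℝ

  Point : Set c
  Point = Carrier × Carrier

  ξ η : Point → Carrier
  ξ = proj₁
  η = proj₂

  infix 4 _≋_
  infixl 6 _⊕_ _⊖_
  infixr 7 _⊛_

  _≋_ : Rel Point ℓ₁
  X ≋ Y = ξ X ≈ ξ Y × η X ≈ η Y

  _⊕_ _⊖_ : Point → Point → Point
  X ⊕ Y = ξ X + ξ Y , η X + η Y
  X ⊖ Y = ξ X - ξ Y , η X - η Y

  _⊛_ : ℤ → Point → Point
  m ⊛ X = fromℤ m * ξ X , fromℤ m * η X

  𝟎 : Point
  𝟎 = 0# , 0#

  Φ : ℤ → ℤ → Point
  Φ x y = a₀ * fromℤ x + b₀ * fromℤ y + c₀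
        , a₁ * fromℤ x + b₁ * fromℤ y + c₁

  -- F_I at a lattice point Φ x y, extended to the whole plane.
  form : Point → Carrier
  form X = ξ X * η X

  IsLatticePoint : Pred Point ℓ₁
  IsLatticePoint P = ∃[ x ] ∃[ y ] P ≋ Φ x y

  IsDifference : Pred Point (c ⊔ ℓ₁)
  IsDifference w =
    ∃[ P ] ∃[ Q ] (IsLatticePoint P × IsLatticePoint Q × w ≋ P ⊖ Q)

  Quadrant : Set
  Quadrant = Sign × Sign

  signed : Sign → Carrier → Carrier
  signed Sign.+ x = x
  signed Sign.- x = - x

  infix 4 _∈Q_

  _∈Q_ : Point → Quadrant → Set (ℓ₁ ⊔ ℓ₂)
  X ∈Q (s , t) = 0# ≤ signed s (ξ X) × 0# ≤ signed t (η X)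

  record IsBasis (u v : Point) : Set (c ⊔ ℓ₁) where
    field
      u-difference : IsDifference u
      v-difference : IsDifference v
      spanning     : ∀ w → IsDifference w →
                     ∃[ m ] ∃[ n ] w ≋ m ⊛ u ⊕ n ⊛ v
      independent  : ∀ m n → m ⊛ u ⊕ n ⊛ v ≋ 𝟎 → m ≡ + 0 × n ≡ + 0

  record Cell : Set (c ⊔ ℓ₁) where
    field
      base         : Point
      base-lattice : IsLatticePoint base
      u v          : Point
      basis        : IsBasis u v

    vertex : Bool × Bool → Point
    vertex (false , false) = base
    vertex (true  , false) = base ⊕ u
    vertex (false , true)  = base ⊕ v
    vertex (true  , true)  = base ⊕ u ⊕ v

  -- Quadrants are closed, so a vertex on an axis lies in several of them; the
  -- four vertices have to be matched bijectively with the four quadrants.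
  IsDivided : Pred Cell (ℓ₁ ⊔ ℓ₂)
  IsDivided C = ∃ λ (σ : (Bool × Bool) ↔ Quadrant) →
    ∀ i → Cell.vertex C i ∈Q Inverse.to σ i

  DividedCellsExist : Set (c ⊔ ℓ₁ ⊔ ℓ₂)
  DividedCellsExist = ∃ IsDivided

  IsVertexOfDividedCell : Pred Point (c ⊔ ℓ₁ ⊔ ℓ₂)
  IsVertexOfDividedCell P =
    ∃[ C ] (IsDivided C × ∃[ i ] P ≋ Cell.vertex C i)

  BasicOrder : Rel Point (ℓ₁ ⊔ ℓ₂)
  BasicOrder P Q = IsLatticePoint P × IsLatticePoint Q ×
    ∃[ q ] (P ∈Q q × Q ∈Q q × ∣ ξ P ∣ ≤ ∣ ξ Q ∣ × ∣ η P ∣ ≤ ∣ η Q ∣)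

  record Line : Set (c ⊔ ℓ₁) where
    field
      α β γ      : Carrier
      nontrivial : ¬ (α ≈ 0# × β ≈ 0#)

  infix 4 _∈L_

  _∈L_ : Point → Line → Set ℓ₁
  X ∈L L = α * ξ X + β * η X ≈ γ
    where open Line L

  IsLatticeLine : Pred Line (c ⊔ ℓ₁)
  IsLatticeLine L = ∃[ A ] ∃[ B ]
    (IsLatticePoint A × IsLatticePoint B × ¬ A ≋ B × A ∈L L × B ∈L L)

  Section : Line → Quadrant → Pred Point (ℓ₁ ⊔ ℓ₂)
  Section L q X = X ∈L L × X ∈Q q

  IsBounded : ∀ {p} → Pred (Pred Point p) (c ⊔ ℓ₁ ⊔ ℓ₂ ⊔ p)
  IsBounded S = ∃[ r ] (∀ X → S X → ∣ ξ X ∣ ≤ r × ∣ η X ∣ ≤ r)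

  IsMaximumPoint : ∀ {p} → Pred Point p → Pred Point (c ⊔ ℓ₁ ⊔ ℓ₂ ⊔ p)
  IsMaximumPoint S M = S M × (∀ X → S X → ∣ form X ∣ ≤ ∣ form M ∣)

  dot : Point → Point → Carrier
  dot X Y = ξ X * ξ Y + η X * η Y

  distance² : Point → Point → Carrier
  distance² X Y = dot (X ⊖ Y) (X ⊖ Y)

  -- For P, Q, M on one line: M does not lie strictly between P and Q.  The
  -- sides are closed, that is, M itself belongs to both.
  SameSide : Point → Rel Point (ℓ₁ ⊔ ℓ₂)
  SameSide M P Q = 0# ≤ dot (P ⊖ M) (Q ⊖ M)

  -- The point farther from M is the smaller one: |ξη| decreases away from M,
  -- so, like the basic order, this relation is monotone in |ξη|.  The opposite
  -- orientation does not combine with the basic order to a partial order: on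
  -- ℤ² it gives (20,20) ≤ (10,29) ≤ (14,15) ≤ (20,20).  With it, moreover,
  -- (-3/2, 3/2) would be minimal for (4x + y + 3/2)(y + 1/2), although it is
  -- not a vertex of a divided cell.
  record LineOrder (P Q : Point) : Set (c ⊔ ℓ₁ ⊔ ℓ₂) where
    field
      P-lattice    : IsLatticePoint P
      Q-lattice    : IsLatticePoint Q
      line         : Line
      lattice-line : IsLatticeLine line
      quadrant     : Quadrant
      bounded      : IsBounded (Section line quadrant)
      P-on         : Section line quadrant P
      Q-on         : Section line quadrant Q
      M            : Point
      M-maximum    : IsMaximumPoint (Section line quadrant) M
      same-side    : SameSide M P Q
      farther      : distance² Q M < distance² P M

  ExtendedOrder : Rel Point (c ⊔ ℓ₁ ⊔ ℓ₂)
  ExtendedOrder = TransClosure (BasicOrder ∪ LineOrder)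

  IsMinimal : Pred Point (c ⊔ ℓ₁ ⊔ ℓ₂)
  IsMinimal P = ¬ (∃[ Q ] (IsLatticePoint Q × ¬ Q ≋ P × ExtendedOrder Q P))

{-# OPTIONS --safe #-}

-- If P is minimal and w ≠ 0 is a difference of lattice points with |ξ w| ≤ |ξ P|
-- and |η w| ≤ |η P|, then P + w and P - w lie in the quadrant of P, and one of
-- them is smaller than P: in the basic order if w lies in that quadrant up to
-- sign, and otherwise along the lattice line through P in direction w.  So only
-- w = 0 satisfies these bounds ("P is empty").
--
-- After changing signs of ξ and η and exchanging them, a divided cell has its
-- vertices A, A - g, A - h, A - g - h in the quadrants (+,+), (-,+), (+,-), (-,-)
-- and P = A + a g + b h with a, b ∈ ℕ.  For a = b > 0 the vector g + h contradicts
-- emptiness.  For a > b the vector g does, unless its second coordinate is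
-- negative; then the lines of the two sides in direction g both cross the first
-- axis, and their segments at the crossings span another divided cell, for which
-- emptiness turns (a , b) into (b , c) with c ≤ b.  The descent ends at a = b = 0,
-- where P = A.

module Submission where

open import Defs
import Algebra.Properties.Monoid.Mult as Mult
import Algebra.Properties.Semiring.Mult as SemiringMult
import Algebra.Properties.Ring as RingProperties
import Algebra.Solver.Ring as RingSolver
open import Algebra.Solver.Ring.AlmostCommutativeRing
  using (fromCommutativeRing; _-Raw-AlmostCommutative⟶_)
open import Data.Bool.Base using (Bool; true; false; not)
open import Data.Empty using (⊥; ⊥-elim)
open import Data.Integer.Base as ℤ using (ℤ; +_; -[1+_])
import Data.Integer.Properties as ℤₚ
open import Data.Maybe.Base using (Maybe; just; nothing)
open import Data.Nat.Base as ℕ using (ℕ; zero; suc)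
open import Data.Nat.Induction using (<-wellFounded)
import Data.Nat.Properties as ℕₚ
open import Data.Product.Base using (∃; ∃-syntax; _×_; _,_; proj₁; proj₂)
open import Data.Product.Algebra using (×-comm)
open import Data.Product.Function.NonDependent.Propositional using (_×-↔_)
open import Data.Sign.Base as Sign using (Sign)
import Data.Sign.Properties as Signₚ
open import Data.Sum.Base using (_⊎_; inj₁; inj₂; [_,_]′)
open import Function.Bundles using (_↔_; Inverse; mk↔ₛ′)
open import Function.Construct.Composition using (_↔-∘_)
open import Induction.WellFounded using (Acc; acc)
open import Level using (Level; Lift; lift; _⊔_)
open import Relation.Binary.Construct.Closure.Transitive using ([_])
open import Relation.Binary.Core using (Rel)
open import Relation.Binary.Definitions using (tri<; tri≈; tri>)
import Relation.Binary.PropositionalEquality as ≡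
open ≡ using (_≡_)
import Relation.Binary.Reasoning.Setoid as SetoidReasoning
open import Relation.Binary.Structures using (IsStrictTotalOrder)
open import Relation.Nullary using (yes; no)
open import Relation.Nullary.Negation.Core using (¬_)

module OrderedField {c ℓ₁ ℓ₂ : Level} (ℝ : RealField c ℓ₁ ℓ₂) where

  open RealField ℝ
  open IsStrictTotalOrder isStrictTotalOrder
    using (compare; irrefl; <-respˡ-≈; <-respʳ-≈) renaming (trans to <-trans)
  open RingProperties ring
    using (-‿involutive; -0#≈0#; -‿distribˡ-*; -‿distribʳ-*; -‿+-comm)
  open SetoidReasoning setoid

  private
    module M = Mult +-monoid
    module SM = SemiringMult semiring

  -- Integers inside the field, and the ring solver.

  fromℕ-+ : ∀ m n → fromℕ (m ℕ.+ n) ≈ fromℕ m + fromℕ n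
  fromℕ-+ = M.×-homo-+ 1#

  fromℕ-* : ∀ m n → fromℕ (m ℕ.* n) ≈ fromℕ m * fromℕ n
  fromℕ-* = SM.×1-homo-*

  fromℤ-neg : ∀ i → fromℤ (ℤ.- i) ≈ - fromℤ i
  fromℤ-neg (+ zero)   = sym -0#≈0#
  fromℤ-neg (+ suc n)  = refl
  fromℤ-neg -[1+ n ]   = sym (-‿involutive _)

  fromℤ-⊖ : ∀ m n → fromℤ (m ℤ.⊖ n) ≈ fromℕ m - fromℕ n
  fromℤ-⊖ m zero = sym (trans (+-congˡ -0#≈0#) (+-identityʳ _))
  fromℤ-⊖ zero (suc n) = sym (+-identityˡ _)
  fromℤ-⊖ (suc m) (suc n) = begin
    fromℤ (suc m ℤ.⊖ suc n)               ≡⟨ ≡.cong fromℤ (ℤₚ.[1+m]⊖[1+n]≡m⊖n m n) ⟩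
    fromℤ (m ℤ.⊖ n)                       ≈⟨ fromℤ-⊖ m n ⟩
    fromℕ m - fromℕ n                     ≈⟨ +-identityˡ _ ⟨
    0# + (fromℕ m - fromℕ n)              ≈⟨ +-congʳ (-‿inverseʳ 1#) ⟨
    (1# - 1#) + (fromℕ m - fromℕ n)       ≈⟨ +-assoc _ _ _ ⟩
    1# + (- 1# + (fromℕ m - fromℕ n))     ≈⟨ +-congˡ (+-assoc _ _ _) ⟨
    1# + (- 1# + fromℕ m - fromℕ n)       ≈⟨ +-congˡ (+-congʳ (+-comm _ _)) ⟩
    1# + (fromℕ m - 1# - fromℕ n)         ≈⟨ +-congˡ (+-assoc _ _ _) ⟩
    1# + (fromℕ m + (- 1# - fromℕ n))     ≈⟨ +-assoc _ _ _ ⟨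
    fromℕ (suc m) + (- 1# - fromℕ n)      ≈⟨ +-congˡ (-‿+-comm _ _) ⟩
    fromℕ (suc m) - fromℕ (suc n)         ∎

  fromℤ-+ : ∀ i j → fromℤ (i ℤ.+ j) ≈ fromℤ i + fromℤ j
  fromℤ-+ (+ m) (+ n) = fromℕ-+ m n
  fromℤ-+ (+ m) -[1+ n ] = fromℤ-⊖ m (suc n)
  fromℤ-+ -[1+ m ] (+ n) = trans (fromℤ-⊖ n (suc m)) (+-comm _ _)
  fromℤ-+ -[1+ m ] -[1+ n ] = begin
    - fromℕ (suc (suc (m ℕ.+ n)))          ≡⟨ ≡.cong (λ k → - fromℕ (suc k)) (ℕₚ.+-suc m n) ⟨
    - fromℕ (suc m ℕ.+ suc n)              ≈⟨ -‿cong (fromℕ-+ (suc m) (suc n)) ⟩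
    - (fromℕ (suc m) + fromℕ (suc n))      ≈⟨ -‿+-comm _ _ ⟨
    - fromℕ (suc m) + - fromℕ (suc n)      ∎

  -- Integer multiplication is defined by multiplying signs and absolute values separately, so the
  -- argument splits both factors in the same way.
  fromℤ-* : ∀ i j → fromℤ (i ℤ.* j) ≈ fromℤ i * fromℤ j
  fromℤ-* i j = begin
    fromℤ (i ℤ.* j)
      ≈⟨ from-◃ (ℤ.sign i Sign.* ℤ.sign j) (ℤ.∣ i ∣ ℕ.* ℤ.∣ j ∣) ⟩
    signedᵣ (ℤ.sign i Sign.* ℤ.sign j) (fromℕ (ℤ.∣ i ∣ ℕ.* ℤ.∣ j ∣))
      ≈⟨ signed-cong (ℤ.sign i Sign.* ℤ.sign j) (fromℕ-* ℤ.∣ i ∣ ℤ.∣ j ∣) ⟩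
    signedᵣ (ℤ.sign i Sign.* ℤ.sign j) (fromℕ ℤ.∣ i ∣ * fromℕ ℤ.∣ j ∣)
      ≈⟨ signed-* (ℤ.sign i) (ℤ.sign j) _ _ ⟩
    signedᵣ (ℤ.sign i) (fromℕ ℤ.∣ i ∣) * signedᵣ (ℤ.sign j) (fromℕ ℤ.∣ j ∣)
      ≡⟨ ≡.cong₂ _*_ (from-abs i) (from-abs j) ⟩
    fromℤ i * fromℤ j ∎
    where
    signedᵣ : Sign → Carrier → Carrier
    signedᵣ Sign.+ x = x
    signedᵣ Sign.- x = - x

    from-◃ : ∀ s n → fromℤ (s ℤ.◃ n) ≈ signedᵣ s (fromℕ n)
    from-◃ Sign.+ zero    = refl
    from-◃ Sign.+ (suc n) = refl
    from-◃ Sign.- zero    = sym -0#≈0#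
    from-◃ Sign.- (suc n) = refl

    from-abs : ∀ i → signedᵣ (ℤ.sign i) (fromℕ ℤ.∣ i ∣) ≡ fromℤ i
    from-abs (+ n)    = ≡.refl
    from-abs -[1+ n ] = ≡.refl

    signed-cong : ∀ s {x y} → x ≈ y → signedᵣ s x ≈ signedᵣ s y
    signed-cong Sign.+ = λ e → e
    signed-cong Sign.- = -‿cong

    signed-* : ∀ s t x y → signedᵣ (s Sign.* t) (x * y) ≈ signedᵣ s x * signedᵣ t y
    signed-* Sign.+ Sign.+ x y = refl
    signed-* Sign.+ Sign.- x y = -‿distribʳ-* x y
    signed-* Sign.- Sign.+ x y = -‿distribˡ-* x y
    signed-* Sign.- Sign.- x y = begin
      x * y         ≈⟨ -‿involutive _ ⟨
      - - (x * y)   ≈⟨ -‿cong (-‿distribˡ-* x y) ⟩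
      - (- x * y)   ≈⟨ -‿distribʳ-* (- x) y ⟩
      - x * - y     ∎

  fromℤ-homomorphism :
    ℤ.+-*-rawRing -Raw-AlmostCommutative⟶ fromCommutativeRing commutativeRing
  fromℤ-homomorphism = record
    { ⟦_⟧    = fromℤ
    ; +-homo = fromℤ-+
    ; *-homo = fromℤ-*
    ; -‿homo = fromℤ-neg
    ; 0-homo = refl
    ; 1-homo = +-identityʳ 1#
    }

  -- Coefficients are compared as integers because comparisons in the abstract field do not compute,
  -- and the normal forms of the solver would get stuck on them.
  coefficient≟ : ∀ i j → Maybe (fromℤ i ≈ fromℤ j)
  coefficient≟ i j with i ℤₚ.≟ j
  ... | yes ≡.refl = just refl
  ... | no _       = nothing

  module Solver = RingSolver ℤ.+-*-rawRing
    (fromCommutativeRing commutativeRing) fromℤ-homomorphism coefficient≟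

  open Solver using (solve; _:=_; _:+_; _:*_; _:-_; :-_; con)

  -- Inequalities as nonnegativity of differences.

  0≤-cong : ∀ {x y} → x ≈ y → 0# ≤ x → 0# ≤ y
  0≤-cong x≈y (inj₁ 0<x) = inj₁ (<-respʳ-≈ x≈y 0<x)
  0≤-cong x≈y (inj₂ 0≈x) = inj₂ (trans 0≈x x≈y)

  <⇒0<- : ∀ {x y} → x < y → 0# < y - x
  <⇒0<- {x} x<y = <-respˡ-≈ (-‿inverseʳ x) (+-monoˡ-< (- x) x<y)

  0<-⇒< : ∀ {x y} → 0# < y - x → x < y
  0<-⇒< {x} {y} 0<y-x = <-respˡ-≈ (+-identityˡ x)
    (<-respʳ-≈ (solve 2 (λ x y → y :- x :+ x := y) refl x y) (+-monoˡ-< x 0<y-x))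

  ≤⇒0≤- : ∀ {x y} → x ≤ y → 0# ≤ y - x
  ≤⇒0≤- (inj₁ x<y) = inj₁ (<⇒0<- x<y)
  ≤⇒0≤- {x} (inj₂ x≈y) = inj₂ (trans (sym (-‿inverseʳ x)) (+-congʳ x≈y))

  0≤-⇒≤ : ∀ {x y} → 0# ≤ y - x → x ≤ y
  0≤-⇒≤ (inj₁ 0<y-x) = inj₁ (0<-⇒< 0<y-x)
  0≤-⇒≤ {x} {y} (inj₂ 0≈y-x) = inj₂ (trans (sym (+-identityˡ x)) (trans (+-congʳ 0≈y-x)
    (solve 2 (λ x y → y :- x :+ x := y) refl x y)))

  0<+0≤ : ∀ {x y} → 0# < x → 0# ≤ y → 0# < x + y
  0<+0≤ {x} {y} 0<x (inj₁ 0<y) =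
    <-trans 0<y (<-respˡ-≈ (+-identityˡ y) (+-monoˡ-< y 0<x))
  0<+0≤ {x} 0<x (inj₂ 0≈y) =
    <-respʳ-≈ (trans (sym (+-identityʳ x)) (+-congˡ 0≈y)) 0<x

  infixl 6 _⟨+⟩_
  infixl 7 _⟨*⟩_

  -- With `_⟨*⟩_` this lets a proof of nonnegativity mirror the term it is about. Later inequalities
  -- are such proofs, transported by `0≤-cong` along an identity from the solver.
  _⟨+⟩_ : ∀ {x y} → 0# ≤ x → 0# ≤ y → 0# ≤ x + y
  inj₁ 0<x ⟨+⟩ 0≤y = inj₁ (0<+0≤ 0<x 0≤y)
  inj₂ 0≈x ⟨+⟩ 0≤y = 0≤-cong (trans (sym (+-identityˡ _)) (+-congʳ 0≈x)) 0≤y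

  _⟨*⟩_ : ∀ {x y} → 0# ≤ x → 0# ≤ y → 0# ≤ x * y
  inj₁ 0<x ⟨*⟩ inj₁ 0<y = inj₁ (*-positive 0<x 0<y)
  inj₁ 0<x ⟨*⟩ inj₂ 0≈y = inj₂ (trans (sym (zeroʳ _)) (*-congˡ 0≈y))
  inj₂ 0≈x ⟨*⟩ 0≤y      = inj₂ (trans (sym (zeroˡ _)) (*-congʳ 0≈x))

  sign? : ∀ x → 0# ≤ x ⊎ 0# < - x
  sign? x with compare x 0#
  ... | tri< x<0 _ _ = inj₂ (<-respʳ-≈ (+-identityˡ _) (<⇒0<- x<0))
  ... | tri≈ _ x≈0 _ = inj₁ (inj₂ (sym x≈0))
  ... | tri> _ _ 0<x = inj₁ (inj₁ 0<x)

  0≮0 : ∀ {x} → x ≈ 0# → ¬ 0# < x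
  0≮0 x≈0 = irrefl (sym x≈0)

  0<⇒0≰- : ∀ {x} → 0# < x → ¬ 0# ≤ - x
  0<⇒0≰- {x} 0<x 0≤-x = 0≮0 (-‿inverseʳ x) (0<+0≤ 0<x 0≤-x)

  0≤-antisym : ∀ {x} → 0# ≤ x → 0# ≤ - x → x ≈ 0#
  0≤-antisym (inj₁ 0<x) 0≤-x = ⊥-elim (0<⇒0≰- 0<x 0≤-x)
  0≤-antisym (inj₂ 0≈x) _    = sym 0≈x

  0≤x² : ∀ x → 0# ≤ x * x
  0≤x² x with sign? x
  ... | inj₁ 0≤x  = 0≤x ⟨*⟩ 0≤x
  ... | inj₂ 0<-x = 0≤-cong (solve 1 (λ x → (:- x) :* (:- x) := x :* x) refl x)
                      (inj₁ 0<-x ⟨*⟩ inj₁ 0<-x)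

  -- The solver constant `con (+ 1)` denotes `fromℕ 1`, which unfolds to `1# + 0#` and not to `1#`.
  0≤1 : 0# ≤ fromℕ 1
  0≤1 = 0≤-cong (sym (+-identityʳ 1#)) (inj₁ 0<1)

  fromℕ-nonneg : ∀ n → 0# ≤ fromℕ n
  fromℕ-nonneg zero    = inj₂ refl
  fromℕ-nonneg (suc n) = inj₁ 0<1 ⟨+⟩ fromℕ-nonneg n

  -- The factor y + x of the difference of squares is written as (y - x) + 2x, a sum of nonnegative
  -- terms.
  square-mono : ∀ {x y} → 0# ≤ x → 0# ≤ y - x → 0# ≤ y * y - x * x
  square-mono {x} {y} 0≤x 0≤y-x = 0≤-cong
    (solve 2 (λ x y → (y :- x) :* (y :- x :+ (x :+ x)) := y :* y :- x :* x) refl x y)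
    (0≤y-x ⟨*⟩ (0≤y-x ⟨+⟩ (0≤x ⟨+⟩ 0≤x)))

  -- If y < x, then x² - y² = (x - y)((x - y) + 2y) is positive. The sign of x is arbitrary, so a
  -- bound on x² also controls -x.
  square-cancel : ∀ {x y} → 0# ≤ y → 0# ≤ y * y - x * x → 0# ≤ y - x
  square-cancel {x} {y} 0≤y 0≤y²-x² with sign? (y - x)
  ... | inj₁ 0≤y-x = 0≤y-x
  ... | inj₂ 0<x-y = ⊥-elim (0<⇒0≰- (*-positive 0<x-y 0<x+y)
      (0≤-cong (solve 2 (λ x y → y :* y :- x :* x :=
         :- ((:- (y :- x)) :* ((:- (y :- x)) :+ (y :+ y)))) refl x y) 0≤y²-x²))
    where
    0<x+y : 0# < - (y - x) + (y + y)
    0<x+y = 0<+0≤ 0<x-y (0≤y ⟨+⟩ 0≤y)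

  0<2 : 0# < fromℕ 2
  0<2 = 0<+0≤ 0<1 0≤1

  -- Reciprocals, the Archimedean property and division with remainder.

  reciprocal : ∀ {x} → 0# < x → ∃[ y ] (0# < y × x * y ≈ 1#)
  reciprocal {x} 0<x with inverse x (λ x≈0 → 0≮0 x≈0 0<x)
  ... | y , xy≈1 with sign? y
  ...   | inj₁ (inj₁ 0<y) = y , 0<y , xy≈1
  ...   | inj₁ (inj₂ 0≈y) = ⊥-elim (0≮0
            (trans (sym xy≈1) (trans (*-congˡ (sym 0≈y)) (zeroʳ x))) 0<1)
  ...   | inj₂ 0<-y = ⊥-elim (0<⇒0≰- 0<1 (0≤-cong
            (trans (solve 2 (λ x y → x :* (:- y) := :- (x :* y)) refl x y) (-‿cong xy≈1))
            (inj₁ (*-positive 0<x 0<-y))))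

  -- Let s be the supremum of the numbers up to y that some multiple of γ reaches; the clause
  -- `x ≤ y` keeps this set bounded. A member exceeds s - γ, so the multiple after the one reaching
  -- it exceeds s. If that multiple were still below y, it would belong to the set.
  archimedean : ∀ {y γ} → 0# ≤ y → 0# < γ → ∃[ n ] 0# ≤ fromℕ n * γ - y
  archimedean {y} {γ} 0≤y 0<γ =
    let s , s-upper , s-least = complete Reached
          (0# , lift ((0 , inj₂ zero-multiple) , 0≤y)) (y , λ { x (lift (_ , x≤y)) → x≤y })
        x , lift ((n , x≤nγ) , _) , s-γ<x = s-least (s - γ) (s-γ<s s)
    in suc n , exceeds s-upper n (next s-γ<x n x≤nγ)
    where
    Reached : Carrier → Set (c ⊔ ℓ₁ ⊔ ℓ₂)
    Reached x = Lift (c ⊔ ℓ₁ ⊔ ℓ₂) ((∃[ n ] 0# ≤ fromℕ n * γ - x) × x ≤ y)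

    zero-multiple : 0# ≈ 0# * γ - 0#
    zero-multiple = solve 1 (λ γ → con (+ 0) := con (+ 0) :* γ :- con (+ 0)) refl γ

    s-γ<s : ∀ s → s - γ < s
    s-γ<s s = 0<-⇒< (<-respʳ-≈ (solve 2 (λ γ s → γ := s :- (s :- γ)) refl γ s) 0<γ)

    next : ∀ {s x} → s - γ < x → ∀ n → 0# ≤ fromℕ n * γ - x → 0# < fromℕ (suc n) * γ - s
    next {s} {x} s-γ<x n x≤nγ = <-respʳ-≈
      (trans (solve 4 (λ x s γ ν → x :- (s :- γ) :+ (ν :* γ :- x)
                                     := (con (+ 1) :+ ν) :* γ :- s) refl x s γ (fromℕ n))
             (+-congʳ (*-congʳ (sym (fromℕ-+ 1 n)))))
      (0<+0≤ (<⇒0<- s-γ<x) x≤nγ)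

    exceeds : ∀ {s} → IsUpperBound Reached s → ∀ n → 0# < fromℕ (suc n) * γ - s →
              0# ≤ fromℕ (suc n) * γ - y
    exceeds {s} s-upper n s<[1+n]γ with sign? (fromℕ (suc n) * γ - y)
    ... | inj₁ y≤[1+n]γ = y≤[1+n]γ
    ... | inj₂ [1+n]γ<y = ⊥-elim (0<⇒0≰- s<[1+n]γ
      (0≤-cong (solve 2 (λ z s → s :- z := :- (z :- s)) refl (fromℕ (suc n) * γ) s)
        (≤⇒0≤- (s-upper (fromℕ (suc n) * γ) (lift
          ((suc n , inj₂ (sym (-‿inverseʳ (fromℕ (suc n) * γ)))) ,
           0≤-⇒≤ (0≤-cong
             (solve 2 (λ z y → :- (z :- y) := y :- z) refl (fromℕ (suc n) * γ) y)
             (inj₁ [1+n]γ<y))))))))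

  -- `k` is the integer part of y / γ, found by counting down from an Archimedean bound until a
  -- multiple of γ is at most y.
  quotient : ∀ {y γ} → 0# ≤ y → 0# < γ →
             ∃[ k ] (0# ≤ y - fromℕ k * γ × 0# ≤ fromℕ (suc k) * γ - y)
  quotient {y} {γ} 0≤y 0<γ = below (proj₁ bound) (proj₂ bound)
    where
    bound = archimedean 0≤y 0<γ

    below : ∀ n → 0# ≤ fromℕ n * γ - y →
            ∃[ k ] (0# ≤ y - fromℕ k * γ × 0# ≤ fromℕ (suc k) * γ - y)
    below zero 0≤-y = 0
      , 0≤-cong (solve 2 (λ y γ → y := y :- con (+ 0) :* γ) refl y γ) 0≤y
      , 0≤-cong (solve 2 (λ y γ → γ :+ (con (+ 0) :* γ :- y) := con (+ 1) :* γ :- y) refl y γ)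
          (inj₁ 0<γ ⟨+⟩ 0≤-y)
    below (suc n) 0≤nγ-y with sign? (y - fromℕ n * γ)
    ... | inj₁ 0≤r  = n , 0≤r , 0≤nγ-y
    ... | inj₂ 0<-r = below n
      (0≤-cong (solve 2 (λ y z → :- (y :- z) := z :- y) refl y _) (inj₁ 0<-r))

  -- Divided cells in plane coordinates.

  -- The points (x , y), (x , y) - g, (x , y) - h and (x , y) - g - h lie in the
  -- quadrants (+,+), (-,+), (+,-) and (-,-).
  record Divided (x y g₁ g₂ h₁ h₂ : Carrier) : Set (ℓ₁ ⊔ ℓ₂) where
    field
      0≤x     : 0# ≤ x
      0≤y     : 0# ≤ y
      x≤g₁    : 0# ≤ g₁ - x
      g₂≤y    : 0# ≤ y - g₂
      h₁≤x    : 0# ≤ x - h₁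
      y≤h₂    : 0# ≤ h₂ - y
      x≤g₁+h₁ : 0# ≤ g₁ + h₁ - x
      y≤g₂+h₂ : 0# ≤ g₂ + h₂ - y

    0≤g₁ : 0# ≤ g₁
    0≤g₁ = 0≤-cong (solve 2 (λ x g → x :+ (g :- x) := g) refl x g₁) (0≤x ⟨+⟩ x≤g₁)

    0≤g₁+h₁ : 0# ≤ g₁ + h₁
    0≤g₁+h₁ = 0≤-cong (solve 2 (λ x z → x :+ (z :- x) := z) refl x (g₁ + h₁))
      (0≤x ⟨+⟩ x≤g₁+h₁)

    0≤g₂+h₂ : 0# ≤ g₂ + h₂
    0≤g₂+h₂ = 0≤-cong (solve 2 (λ x z → x :+ (z :- x) := z) refl y (g₂ + h₂))
      (0≤y ⟨+⟩ y≤g₂+h₂)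

    0≤h₂ : 0# ≤ h₂
    0≤h₂ = 0≤-cong (solve 2 (λ y h → y :+ (h :- y) := h) refl y h₂) (0≤y ⟨+⟩ y≤h₂)

  Divided-cong : ∀ {x y g₁ g₂ h₁ h₂ x′ y′ g₁′ g₂′ h₁′ h₂′} →
    x ≈ x′ → y ≈ y′ → g₁ ≈ g₁′ → g₂ ≈ g₂′ → h₁ ≈ h₁′ → h₂ ≈ h₂′ →
    Divided x y g₁ g₂ h₁ h₂ → Divided x′ y′ g₁′ g₂′ h₁′ h₂′
  Divided-cong x y g₁ g₂ h₁ h₂ D = record
    { 0≤x     = 0≤-cong x 0≤x
    ; 0≤y     = 0≤-cong y 0≤y
    ; x≤g₁    = 0≤-cong (+-cong g₁ (-‿cong x)) x≤g₁
    ; g₂≤y    = 0≤-cong (+-cong y (-‿cong g₂)) g₂≤y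
    ; h₁≤x    = 0≤-cong (+-cong x (-‿cong h₁)) h₁≤x
    ; y≤h₂    = 0≤-cong (+-cong h₂ (-‿cong y)) y≤h₂
    ; x≤g₁+h₁ = 0≤-cong (+-cong (+-cong g₁ h₁) (-‿cong x)) x≤g₁+h₁
    ; y≤g₂+h₂ = 0≤-cong (+-cong (+-cong g₂ h₂) (-‿cong y)) y≤g₂+h₂
    }
    where open Divided D

  -- Exchanging the axes interchanges the quadrants (-,+) and (+,-), hence the roles of g and h as
  -- well as their coordinates.
  Divided-swap : ∀ {x y g₁ g₂ h₁ h₂} →
    Divided x y g₁ g₂ h₁ h₂ → Divided y x h₂ h₁ g₂ g₁
  Divided-swap D = record
    { 0≤x = 0≤y ; 0≤y = 0≤x ; x≤g₁ = y≤h₂ ; g₂≤y = h₁≤x ; h₁≤x = g₂≤y ; y≤h₂ = x≤g₁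
    ; x≤g₁+h₁ = 0≤-cong (+-congʳ (+-comm _ _)) y≤g₂+h₂
    ; y≤g₂+h₂ = 0≤-cong (+-congʳ (+-comm _ _)) x≤g₁+h₁
    }
    where open Divided D

  -- Reflection in the horizontal axis carries A - h from (+,-) to (+,+), where it is the new
  -- corner. The side along h is then traversed backwards, so h is negated before it is reflected.
  Divided-reflect : ∀ {x y g₁ g₂ h₁ h₂} → Divided x y g₁ g₂ h₁ h₂ →
    Divided (x - h₁) (- (y - h₂)) g₁ (- g₂) (- h₁) (- - h₂)
  Divided-reflect {x} {y} {g₁} {g₂} {h₁} {h₂} D = record
    { 0≤x = h₁≤x
    ; 0≤y = 0≤-cong (solve 2 (λ y h → h :- y := :- (y :- h)) refl y h₂) y≤h₂
    ; x≤g₁ = 0≤-cong (solve 3 (λ x g h → g :+ h :- x := g :- (x :- h)) refl x g₁ h₁) x≤g₁+h₁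
    ; g₂≤y = 0≤-cong (solve 3 (λ y g h → g :+ h :- y := :- (y :- h) :- (:- g)) refl y g₂ h₂)
               y≤g₂+h₂
    ; h₁≤x = 0≤-cong (solve 2 (λ x h → x := x :- h :- (:- h)) refl x h₁) 0≤x
    ; y≤h₂ = 0≤-cong (solve 2 (λ y h → y := :- (:- h) :- (:- (y :- h))) refl y h₂) 0≤y
    ; x≤g₁+h₁ = 0≤-cong (solve 3 (λ x g h → g :- x := g :+ (:- h) :- (x :- h)) refl x g₁ h₁)
                  x≤g₁
    ; y≤g₂+h₂ = 0≤-cong (solve 3 (λ y g h → y :- g := :- g :+ (:- (:- h)) :- (:- (y :- h)))
                  refl y g₂ h₂) g₂≤y
    }
    where open Divided D

  -- The side in direction g descends, so its line and the opposite one both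
  -- cross the horizontal axis; the new cell has a side on each of these lines,
  -- the one that straddles this axis.
  Divided-turn : ∀ {x y g₁ g₂ h₁ h₂} → Divided x y g₁ g₂ h₁ h₂ → 0# < - g₂ →
    ∃[ k ] ∃[ m ] Divided (x + fromℕ k * g₁) (y + fromℕ k * g₂)
                          (h₁ + fromℕ m * g₁) (h₂ + fromℕ m * g₂) (- g₁) (- g₂)
  Divided-turn {x} {y} {g₁} {g₂} {h₁} {h₂} D 0<-g₂ =
    -- Going from A by steps g, `k` of them stay above the axis; going from A - g - h by steps -g,
    -- `l` of them stay below it. The new corner is A + k g, and the multiple k + 2 + l of g, added
    -- to h, puts the vertex of (-,+) at A - g - h - (l + 1) g.
    let k , k≤ , ≤1+k = quotient 0≤y 0<-g₂
        l , l≤ , ≤1+l = quotient y≤g₂+h₂ 0<-g₂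
    in k , k ℕ.+ (2 ℕ.+ l) ,
       Divided-cong refl refl (+-congˡ (*-congʳ (multiple k l)))
         (+-congˡ (*-congʳ (multiple k l))) refl refl
         (turned (fromℕ k) (fromℕ l) (fromℕ-nonneg k) (fromℕ-nonneg l) k≤
           (0≤-cong (+-congʳ (*-congʳ (fromℕ-+ 1 k))) ≤1+k) l≤
           (0≤-cong (+-congʳ (*-congʳ (fromℕ-+ 1 l))) ≤1+l))
    where
    open Divided D

    multiple : ∀ k l → fromℕ k + (fromℕ 2 + fromℕ l) ≈ fromℕ (k ℕ.+ (2 ℕ.+ l))
    multiple k l = sym (trans (fromℕ-+ k (2 ℕ.+ l)) (+-congˡ (fromℕ-+ 2 l)))

    -- Numbers κ and λ′ replace `fromℕ k` and `fromℕ l`, and successors become `fromℕ 1 + κ`, so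
    -- that all identities are polynomial ones for the solver.
    turned : ∀ κ λ′ → 0# ≤ κ → 0# ≤ λ′ →
      0# ≤ y - κ * - g₂ → 0# ≤ (fromℕ 1 + κ) * - g₂ - y →
      0# ≤ g₂ + h₂ - y - λ′ * - g₂ → 0# ≤ (fromℕ 1 + λ′) * - g₂ - (g₂ + h₂ - y) →
      Divided (x + κ * g₁) (y + κ * g₂)
              (h₁ + (κ + (fromℕ 2 + λ′)) * g₁) (h₂ + (κ + (fromℕ 2 + λ′)) * g₂)
              (- g₁) (- g₂)
    turned κ λ′ 0≤κ 0≤λ k≤ ≤1+k l≤ ≤1+l = record
      { 0≤x = 0≤x ⟨+⟩ 0≤κ ⟨*⟩ 0≤g₁
      ; 0≤y = 0≤-cong (solve 3 (λ y κ g → y :- κ :* (:- g) := y :+ κ :* g) refl y κ g₂) k≤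
      ; x≤g₁ = 0≤-cong (solve 5 (λ x g h κ l →
            g :+ h :- x :+ (con (+ 1) :+ l) :* g :=
            h :+ (κ :+ (con (+ 2) :+ l)) :* g :- (x :+ κ :* g)) refl x g₁ h₁ κ λ′)
          (x≤g₁+h₁ ⟨+⟩ (0≤1 ⟨+⟩ 0≤λ) ⟨*⟩ 0≤g₁)
      ; g₂≤y = 0≤-cong (solve 5 (λ y g h κ l →
            (con (+ 1) :+ l) :* (:- g) :- (g :+ h :- y) :=
            y :+ κ :* g :- (h :+ (κ :+ (con (+ 2) :+ l)) :* g)) refl y g₂ h₂ κ λ′) ≤1+l
      ; h₁≤x = 0≤-cong (solve 3 (λ x κ g → x :+ κ :* g :+ g := x :+ κ :* g :- (:- g))
            refl x κ g₁)
          (0≤x ⟨+⟩ 0≤κ ⟨*⟩ 0≤g₁ ⟨+⟩ 0≤g₁)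
      ; y≤h₂ = 0≤-cong (solve 3 (λ y κ g → (con (+ 1) :+ κ) :* (:- g) :- y :=
            (:- g) :- (y :+ κ :* g)) refl y κ g₂) ≤1+k
      ; x≤g₁+h₁ = 0≤-cong (solve 5 (λ x g h κ l →
            g :+ h :- x :+ l :* g :=
            h :+ (κ :+ (con (+ 2) :+ l)) :* g :+ (:- g) :- (x :+ κ :* g)) refl x g₁ h₁ κ λ′)
          (x≤g₁+h₁ ⟨+⟩ 0≤λ ⟨*⟩ 0≤g₁)
      ; y≤g₂+h₂ = 0≤-cong (solve 5 (λ y g h κ l →
            g :+ h :- y :- l :* (:- g) :=
            h :+ (κ :+ (con (+ 2) :+ l)) :* g :+ (:- g) :- (y :+ κ :* g)) refl y g₂ h₂ κ λ′) l≤
      }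

  -- p exceeds x + b (g + h) by a - b ≥ 1 further copies of g.
  exceeds-side : ∀ {p x g h a b} → 0# ≤ x → 0# ≤ g → 0# ≤ g + h → b ℕ.< a →
    p ≈ x + fromℕ a * g + fromℕ b * h → 0# ≤ p - g
  exceeds-side {p} {x} {g} {h} {a} {b} 0≤x 0≤g 0≤g+h b<a p≈ = 0≤-cong
    (begin
      x + fromℕ b * (g + h) + fromℕ d * g
        ≈⟨ solve 5 (λ x g h β δ → x :+ β :* (g :+ h) :+ δ :* g :=
             x :+ (con (+ 1) :+ β :+ δ) :* g :+ β :* h :- g) refl
             x g h (fromℕ b) (fromℕ d) ⟩
      x + (fromℕ 1 + fromℕ b + fromℕ d) * g + fromℕ b * h - g
        ≈⟨ +-congʳ (+-congʳ (+-congˡ (*-congʳ (+-congʳ (fromℕ-+ 1 b))))) ⟨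
      x + (fromℕ (suc b) + fromℕ d) * g + fromℕ b * h - g
        ≈⟨ +-congʳ (+-congʳ (+-congˡ (*-congʳ (fromℕ-+ (suc b) d)))) ⟨
      x + fromℕ (suc b ℕ.+ d) * g + fromℕ b * h - g
        ≡⟨ ≡.cong (λ n → x + fromℕ n * g + fromℕ b * h - g) (ℕₚ.m+[n∸m]≡n b<a) ⟩
      x + fromℕ a * g + fromℕ b * h - g
        ≈⟨ +-congʳ p≈ ⟨
      p - g ∎)
    (0≤x ⟨+⟩ fromℕ-nonneg b ⟨*⟩ 0≤g+h ⟨+⟩ fromℕ-nonneg d ⟨*⟩ 0≤g)
    where
    d = a ℕ.∸ suc b

-- Lattice points, their differences, and coordinate frames.

module Lattice
  {c ℓ₁ ℓ₂ : Level} (ℝ : RealField c ℓ₁ ℓ₂)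
  (a₀ b₀ c₀ a₁ b₁ c₁ : RealField.Carrier ℝ) where

  open RealField ℝ
  open OrderedField ℝ
  open Solver using (solve; _:=_; _:+_; _:*_; _:-_; :-_; con)
  open ViewingPlane ℝ a₀ b₀ c₀ a₁ b₁ c₁
  open IsStrictTotalOrder isStrictTotalOrder using (_≟_; compare; <-respʳ-≈)
  open RingProperties ring using (-‿involutive; -0#≈0#)
  open SetoidReasoning setoid

  infix 8 ⊝_

  ⊝_ : Point → Point
  ⊝ X = - ξ X , - η X

  ≋-refl : ∀ {X} → X ≋ X
  ≋-refl = refl , refl

  ≋-sym : ∀ {X Y} → X ≋ Y → Y ≋ X
  ≋-sym (e , f) = sym e , sym f

  ≋-trans : ∀ {X Y Z} → X ≋ Y → Y ≋ Z → X ≋ Z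
  ≋-trans (e , f) (e′ , f′) = trans e e′ , trans f f′

  -- Both coordinates, with either sign, are functionals of this kind, so one argument serves all
  -- frames.
  record Linear (f : Point → Carrier) : Set (c ⊔ ℓ₁) where
    field
      f-cong : ∀ {X Y} → X ≋ Y → f X ≈ f Y
      f-⊕    : ∀ X Y → f (X ⊕ Y) ≈ f X + f Y
      f-⊛    : ∀ m X → f (m ⊛ X) ≈ fromℤ m * f X
      f-⊝    : ∀ X → f (⊝ X) ≈ - f X

    f-⊖ : ∀ X Y → f (X ⊖ Y) ≈ f X - f Y
    f-⊖ X Y = trans (f-⊕ X (⊝ Y)) (+-congˡ (f-⊝ Y))

    f-position : ∀ {P} A g h m n → P ≋ A ⊕ m ⊛ g ⊕ n ⊛ h →
                 f P ≈ f A + fromℤ m * f g + fromℤ n * f h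
    f-position A g h m n P≋ = trans (f-cong P≋) (trans (f-⊕ _ _)
      (+-cong (trans (f-⊕ _ _) (+-congˡ (f-⊛ m g))) (f-⊛ n h)))

  signed-cong : ∀ s {x y} → x ≈ y → signed s x ≈ signed s y
  signed-cong Sign.+ = λ x≈y → x≈y
  signed-cong Sign.- = -‿cong

  signed-opposite : ∀ s x → signed (Sign.opposite s) x ≈ - signed s x
  signed-opposite Sign.+ x = refl
  signed-opposite Sign.- x = sym (-‿involutive x)

  signed-involutive : ∀ s x → signed s (signed s x) ≈ x
  signed-involutive Sign.+ x = refl
  signed-involutive Sign.- x = -‿involutive x

  signed-square : ∀ s x → signed s x * signed s x ≈ x * x
  signed-square Sign.+ x = refl
  signed-square Sign.- x = solve 1 (λ x → (:- x) :* (:- x) := x :* x) refl x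

  signed-linear : ∀ s {f} → Linear f → Linear (λ X → signed s (f X))
  signed-linear Sign.+ L = record { Linear L }
  signed-linear Sign.- {f} L = record
    { f-cong = λ X≋Y → -‿cong (f-cong X≋Y)
    ; f-⊕ = λ X Y → trans (-‿cong (f-⊕ X Y))
        (solve 2 (λ x y → :- (x :+ y) := :- x :- y) refl (f X) (f Y))
    ; f-⊛ = λ m X → trans (-‿cong (f-⊛ m X))
        (solve 2 (λ x y → :- (x :* y) := x :* (:- y)) refl (fromℤ m) (f X))
    ; f-⊝ = λ X → -‿cong (f-⊝ X)
    }
    where open Linear L

  ξ-linear : Linear ξ
  ξ-linear = record
    { f-cong = proj₁ ; f-⊕ = λ _ _ → refl ; f-⊛ = λ _ _ → refl ; f-⊝ = λ _ → refl }

  η-linear : Linear η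
  η-linear = record
    { f-cong = proj₂ ; f-⊕ = λ _ _ → refl ; f-⊛ = λ _ _ → refl ; f-⊝ = λ _ → refl }

  coordinate : Bool → Point → Carrier
  coordinate false = ξ
  coordinate true  = η

  coordinate-linear : ∀ i → Linear (coordinate i)
  coordinate-linear false = ξ-linear
  coordinate-linear true  = η-linear

  -- One of the eight coordinate systems that differ from (ξ , η) by signs and
  -- by the order of the axes; the flag selects the first axis.
  Frame : Set
  Frame = Bool × Sign × Sign

  horizontal vertical : Frame → Point → Carrier
  horizontal (i , s , t) X = signed s (coordinate i X)
  vertical   (i , s , t) X = signed t (coordinate (not i) X)

  horizontal-linear : ∀ φ → Linear (horizontal φ)
  horizontal-linear (i , s , t) = signed-linear s (coordinate-linear i)

  vertical-linear : ∀ φ → Linear (vertical φ)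
  vertical-linear (i , s , t) = signed-linear t (coordinate-linear (not i))

  private
    e₁ e₂ : Point
    e₁ = a₀ , a₁
    e₂ = b₀ , b₁

  Φ-difference : ∀ x y x′ y′ → Φ x y ⊖ Φ x′ y′ ≋ (x ℤ.- x′) ⊛ e₁ ⊕ (y ℤ.- y′) ⊛ e₂
  Φ-difference x y x′ y′ = by a₀ b₀ c₀ , by a₁ b₁ c₁
    where
    by : ∀ a b c → (a * fromℤ x + b * fromℤ y + c) - (a * fromℤ x′ + b * fromℤ y′ + c)
                 ≈ fromℤ (x ℤ.- x′) * a + fromℤ (y ℤ.- y′) * b
    by a b c = trans
      (solve 7 (λ a b c x y x′ y′ →
        (a :* x :+ b :* y :+ c) :- (a :* x′ :+ b :* y′ :+ c)
          := (x :- x′) :* a :+ (y :- y′) :* b) refl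
        a b c (fromℤ x) (fromℤ y) (fromℤ x′) (fromℤ y′))
      (+-cong (*-congʳ (fromℤ-- x x′)) (*-congʳ (fromℤ-- y y′)))
      where
      fromℤ-- : ∀ i j → fromℤ i - fromℤ j ≈ fromℤ (i ℤ.- j)
      fromℤ-- i j = sym (trans (fromℤ-+ i (ℤ.- j)) (+-congˡ (fromℤ-neg j)))

  ⊖-cong : ∀ {X X′ Y Y′} → X ≋ X′ → Y ≋ Y′ → X ⊖ Y ≋ X′ ⊖ Y′
  ⊖-cong (e , f) (e′ , f′) = +-cong e (-‿cong e′) , +-cong f (-‿cong f′)

  -- Together with its converse below, this reduces differences of lattice points to integer
  -- combinations of two fixed vectors, which shows that they form a group.
  difference⇒combination : ∀ {w} → IsDifference w → ∃[ m ] ∃[ n ] w ≋ m ⊛ e₁ ⊕ n ⊛ e₂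
  difference⇒combination (P , Q , (x , y , P≋) , (x′ , y′ , Q≋) , w≋) =
    x ℤ.- x′ , y ℤ.- y′ , ≋-trans w≋ (≋-trans (⊖-cong P≋ Q≋) (Φ-difference x y x′ y′))

  combination⇒difference : ∀ {w} m n → w ≋ m ⊛ e₁ ⊕ n ⊛ e₂ → IsDifference w
  combination⇒difference m n w≋ =
    Φ m n , Φ (+ 0) (+ 0) , (m , n , ≋-refl) , (+ 0 , + 0 , ≋-refl) ,
    ≋-trans w≋ (≋-sym (≋-trans (Φ-difference m n (+ 0) (+ 0))
      (≡.subst₂ (λ i j → i ⊛ e₁ ⊕ j ⊛ e₂ ≋ m ⊛ e₁ ⊕ n ⊛ e₂)
        (≡.sym (ℤₚ.+-identityʳ m)) (≡.sym (ℤₚ.+-identityʳ n)) ≋-refl)))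

  pick₁ : ∀ X Y → X ≋ (+ 1) ⊛ X ⊕ (+ 0) ⊛ Y
  pick₁ X Y = by _ _ , by _ _
    where
    by : ∀ x y → x ≈ fromℤ (+ 1) * x + fromℤ (+ 0) * y
    by = solve 2 (λ x y → x := con (+ 1) :* x :+ con (+ 0) :* y) refl

  pick₂ : ∀ X Y → Y ≋ (+ 0) ⊛ X ⊕ (+ 1) ⊛ Y
  pick₂ X Y = by _ _ , by _ _
    where
    by : ∀ x y → y ≈ fromℤ (+ 0) * x + fromℤ (+ 1) * y
    by = solve 2 (λ x y → y := con (+ 0) :* x :+ con (+ 1) :* y) refl

  e₁-difference : IsDifference e₁
  e₁-difference = combination⇒difference (+ 1) (+ 0) (pick₁ e₁ e₂)

  e₂-difference : IsDifference e₂
  e₂-difference = combination⇒difference (+ 0) (+ 1) (pick₂ e₁ e₂)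

  -- The new coefficients are the row (m , n) times the matrix with rows (p , q) and (r , s).
  substitute : ∀ {w u v u′ v′} m n p q r s →
    w ≋ m ⊛ u ⊕ n ⊛ v → u ≋ p ⊛ u′ ⊕ q ⊛ v′ → v ≋ r ⊛ u′ ⊕ s ⊛ v′ →
    w ≋ (m ℤ.* p ℤ.+ n ℤ.* r) ⊛ u′ ⊕ (m ℤ.* q ℤ.+ n ℤ.* s) ⊛ v′
  substitute m n p q r s (w , w′) (u , u′) (v , v′) = by w u v , by w′ u′ v′
    where
    fromℤ-combination : ∀ i j k l → fromℤ i * fromℤ j + fromℤ k * fromℤ l
                                  ≈ fromℤ (i ℤ.* j ℤ.+ k ℤ.* l)
    fromℤ-combination i j k l =
      sym (trans (fromℤ-+ (i ℤ.* j) (k ℤ.* l)) (+-cong (fromℤ-* i j) (fromℤ-* k l)))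

    by : ∀ {w u v u′ v′} → w ≈ fromℤ m * u + fromℤ n * v →
      u ≈ fromℤ p * u′ + fromℤ q * v′ → v ≈ fromℤ r * u′ + fromℤ s * v′ →
      w ≈ fromℤ (m ℤ.* p ℤ.+ n ℤ.* r) * u′ + fromℤ (m ℤ.* q ℤ.+ n ℤ.* s) * v′
    by {w} {u} {v} {u′} {v′} w≈ u≈ v≈ = begin
      w ≈⟨ w≈ ⟩
      fromℤ m * u + fromℤ n * v ≈⟨ +-cong (*-congˡ u≈) (*-congˡ v≈) ⟩
      fromℤ m * (fromℤ p * u′ + fromℤ q * v′) + fromℤ n * (fromℤ r * u′ + fromℤ s * v′)
        ≈⟨ solve 8 (λ m n p q r s u v →
             m :* (p :* u :+ q :* v) :+ n :* (r :* u :+ s :* v)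
               := (m :* p :+ n :* r) :* u :+ (m :* q :+ n :* s) :* v) refl
             (fromℤ m) (fromℤ n) (fromℤ p) (fromℤ q) (fromℤ r) (fromℤ s) u′ v′ ⟩
      (fromℤ m * fromℤ p + fromℤ n * fromℤ r) * u′
        + (fromℤ m * fromℤ q + fromℤ n * fromℤ s) * v′
        ≈⟨ +-cong (*-congʳ (fromℤ-combination m p n r)) (*-congʳ (fromℤ-combination m q n s)) ⟩
      fromℤ (m ℤ.* p ℤ.+ n ℤ.* r) * u′ + fromℤ (m ℤ.* q ℤ.+ n ℤ.* s) * v′ ∎

  difference-combination : ∀ {w u v} m n → IsDifference u → IsDifference v →
                           w ≋ m ⊛ u ⊕ n ⊛ v → IsDifference w
  difference-combination m n du dv w≋ =
    let p , q , u≋ = difference⇒combination du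
        r , s , v≋ = difference⇒combination dv
    in combination⇒difference (m ℤ.* p ℤ.+ n ℤ.* r) (m ℤ.* q ℤ.+ n ℤ.* s)
         (substitute m n p q r s w≋ u≋ v≋)

  lattice-⊕ : ∀ {A w} → IsLatticePoint A → IsDifference w → IsLatticePoint (A ⊕ w)
  lattice-⊕ {A} {w} (x , y , A≋) d =
    let m , n , w≋ = difference⇒combination d
    in x ℤ.+ m , y ℤ.+ n , by m n (proj₁ A≋) (proj₁ w≋) , by m n (proj₂ A≋) (proj₂ w≋)
    where
    by : ∀ m n {p z a b c} → p ≈ a * fromℤ x + b * fromℤ y + c →
         z ≈ fromℤ m * a + fromℤ n * b →
         p + z ≈ a * fromℤ (x ℤ.+ m) + b * fromℤ (y ℤ.+ n) + c
    by m n {p} {z} {a} {b} {c} p≈ z≈ = begin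
      p + z ≈⟨ +-cong p≈ z≈ ⟩
      a * fromℤ x + b * fromℤ y + c + (fromℤ m * a + fromℤ n * b)
        ≈⟨ solve 7 (λ a b c x y m n →
             a :* x :+ b :* y :+ c :+ (m :* a :+ n :* b)
               := a :* (x :+ m) :+ b :* (y :+ n) :+ c) refl
             a b c (fromℤ x) (fromℤ y) (fromℤ m) (fromℤ n) ⟩
      a * (fromℤ x + fromℤ m) + b * (fromℤ y + fromℤ n) + c
        ≈⟨ +-congʳ (+-cong (*-congˡ (fromℤ-+ x m)) (*-congˡ (fromℤ-+ y n))) ⟨
      a * fromℤ (x ℤ.+ m) + b * fromℤ (y ℤ.+ n) + c ∎

  ⊝-combination : ∀ X Y → ⊝ X ≋ -[1+ 0 ] ⊛ X ⊕ (+ 0) ⊛ Y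
  ⊝-combination X Y = by (ξ X) (ξ Y) , by (η X) (η Y)
    where
    by : ∀ x y → - x ≈ fromℤ -[1+ 0 ] * x + fromℤ (+ 0) * y
    by = solve 2 (λ x y → :- x := con -[1+ 0 ] :* x :+ con (+ 0) :* y) refl

  ⊝-combination₂ : ∀ X Y → ⊝ Y ≋ (+ 0) ⊛ X ⊕ -[1+ 0 ] ⊛ Y
  ⊝-combination₂ X Y = by _ _ , by _ _
    where
    by : ∀ x y → - y ≈ fromℤ (+ 0) * x + fromℤ -[1+ 0 ] * y
    by = solve 2 (λ x y → :- y := con (+ 0) :* x :+ con -[1+ 0 ] :* y) refl

  ⊝-involutive : ∀ X → X ≋ ⊝ ⊝ X
  ⊝-involutive X = sym (-‿involutive _) , sym (-‿involutive _)

  ⊝-≉0 : ∀ {w} → ¬ w ≋ 𝟎 → ¬ ⊝ w ≋ 𝟎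
  ⊝-≉0 w≉0 (e , f) = w≉0 (by e , by f)
    where
    by : ∀ {x} → - x ≈ 0# → x ≈ 0#
    by e = trans (sym (-‿involutive _)) (trans (-‿cong e) -0#≈0#)

  difference-⊝ : ∀ {w} → IsDifference w → IsDifference (⊝ w)
  difference-⊝ {w} d = difference-combination -[1+ 0 ] (+ 0) d d (⊝-combination w w)

  lattice-⊖ : ∀ {A w} → IsLatticePoint A → IsDifference w → IsLatticePoint (A ⊖ w)
  lattice-⊖ A-lattice d = lattice-⊕ A-lattice (difference-⊝ d)

  fromℤ-injective₀ : ∀ m → fromℤ m ≈ 0# → m ≡ + 0
  fromℤ-injective₀ (+ zero)  _ = ≡.refl
  fromℤ-injective₀ (+ suc n) e = ⊥-elim (0≮0 e (0<+0≤ 0<1 (fromℕ-nonneg n)))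
  fromℤ-injective₀ -[1+ n ]  e = ⊥-elim (0≮0
    (trans (sym (-‿involutive _)) (trans (-‿cong e) -0#≈0#))
    (0<+0≤ 0<1 (fromℕ-nonneg n)))

  *-cancel₀ : ∀ {x y} → ¬ y ≈ 0# → x * y ≈ 0# → x ≈ 0#
  *-cancel₀ {x} {y} y≉0 xy≈0 =
    let z , yz≈1 = inverse y y≉0 in begin
    x             ≈⟨ *-identityʳ x ⟨
    x * 1#        ≈⟨ *-congˡ yz≈1 ⟨
    x * (y * z)   ≈⟨ *-assoc x y z ⟨
    x * y * z     ≈⟨ *-congʳ xy≈0 ⟩
    0# * z        ≈⟨ zeroˡ z ⟩
    0#            ∎

  basis-≉0ˡ : ∀ {u v} → IsBasis u v → ¬ u ≋ 𝟎
  basis-≉0ˡ {u} {v} B (e , f) with IsBasis.independent B (+ 1) (+ 0) (by e , by f)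
    where
    by : ∀ {x y} → x ≈ 0# → fromℤ (+ 1) * x + fromℤ (+ 0) * y ≈ 0#
    by {x} {y} x≈0 = trans
      (solve 2 (λ x y → con (+ 1) :* x :+ con (+ 0) :* y := x) refl x y) x≈0
  ... | () , _

  basis-≉0⊕ : ∀ {u v} → IsBasis u v → ¬ u ⊕ v ≋ 𝟎
  basis-≉0⊕ {u} {v} B (e , f) with IsBasis.independent B (+ 1) (+ 1) (by e , by f)
    where
    by : ∀ {x y} → x + y ≈ 0# → fromℤ (+ 1) * x + fromℤ (+ 1) * y ≈ 0#
    by {x} {y} x≈0 = trans
      (solve 2 (λ x y → con (+ 1) :* x :+ con (+ 1) :* y := x :+ y) refl x y) x≈0
  ... | () , _

  -- Bounds on coordinates, and absolute values.

  Empty : Point → Set (c ⊔ ℓ₁ ⊔ ℓ₂)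
  Empty P = ∀ w → IsDifference w → 0# ≤ ξ P * ξ P - ξ w * ξ w →
            0# ≤ η P * η P - η w * η w → w ≋ 𝟎

  -- Squares stand for absolute values here and in `Empty`, since the signs of a frame do not affect
  -- them; the index selects the axis, to suit frames with exchanged axes.
  Within : Bool → Rel Point (ℓ₁ ⊔ ℓ₂)
  Within i P w = 0# ≤ coordinate i P * coordinate i P - coordinate i w * coordinate i w

  Empty-within : ∀ {P} → Empty P → ∀ i {w} → IsDifference w →
                 Within i P w → Within (not i) P w → w ≋ 𝟎
  Empty-within empty false {w} d = empty w d
  Empty-within empty true  {w} d W W′ = empty w d W′ W

  within : ∀ i s {P w} → 0# ≤ signed s (coordinate i w) →
           0# ≤ signed s (coordinate i P) - signed s (coordinate i w) → Within i P w
  within i s 0≤w w≤P = 0≤-cong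
    (+-cong (signed-square s _) (-‿cong (signed-square s _))) (square-mono 0≤w w≤P)

  signed-* : ∀ s x y → signed s x * y ≈ x * signed s y
  signed-* Sign.+ x y = refl
  signed-* Sign.- x y = solve 2 (λ x y → (:- x) :* y := x :* (:- y)) refl x y

  signed-0 : ∀ s → signed s 0# ≈ 0#
  signed-0 Sign.+ = refl
  signed-0 Sign.- = -0#≈0#

  nonneg-sign : ∀ x → ∃[ s ] 0# ≤ signed s x
  nonneg-sign x with sign? x
  ... | inj₁ 0≤x  = Sign.+ , 0≤x
  ... | inj₂ 0<-x = Sign.- , inj₁ 0<-x

  ∣∣-signed : ∀ s {x} → 0# ≤ signed s x → ∣ x ∣ ≈ signed s x
  ∣∣-signed Sign.+ {x} 0≤x with compare x 0#
  ... | tri< x<0 _ _ = ⊥-elim (0<⇒0≰- (<-respʳ-≈ (+-identityˡ _) (<⇒0<- x<0))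
                         (0≤-cong (sym (-‿involutive x)) 0≤x))
  ... | tri≈ _ _ _ = refl
  ... | tri> _ _ _ = refl
  ∣∣-signed Sign.- {x} 0≤-x with compare x 0#
  ... | tri< _ _ _ = refl
  ... | tri≈ _ x≈0 _ = trans x≈0 (trans (sym -0#≈0#) (-‿cong (sym x≈0)))
  ... | tri> _ _ 0<x = ⊥-elim (0<⇒0≰- 0<x 0≤-x)

  ∣∣-product : ∀ s t {x y} → 0# ≤ signed s x → 0# ≤ signed t y →
               ∣ x * y ∣ ≈ signed s x * signed t y
  ∣∣-product s t {x} {y} 0≤x 0≤y = by s t (0≤x ⟨*⟩ 0≤y)
    where
    via : ∀ r {z} → signed r (x * y) ≈ z → 0# ≤ z → ∣ x * y ∣ ≈ z
    via r e 0≤z = trans (∣∣-signed r (0≤-cong (sym e) 0≤z)) e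

    by : ∀ s t → 0# ≤ signed s x * signed t y → ∣ x * y ∣ ≈ signed s x * signed t y
    by Sign.+ Sign.+ = via Sign.+ refl
    by Sign.+ Sign.- = via Sign.- (solve 2 (λ x y → :- (x :* y) := x :* (:- y)) refl x y)
    by Sign.- Sign.+ = via Sign.- (solve 2 (λ x y → :- (x :* y) := (:- x) :* y) refl x y)
    by Sign.- Sign.- = via Sign.+ (solve 2 (λ x y → x :* y := (:- x) :* (:- y)) refl x y)

  ∣∣-mono : ∀ s {x y} → 0# ≤ signed s x → 0# ≤ signed s y → 0# ≤ signed s y - signed s x →
            ∣ x ∣ ≤ ∣ y ∣
  ∣∣-mono s 0≤x 0≤y x≤y = 0≤-⇒≤ (0≤-cong
    (sym (+-cong (∣∣-signed s 0≤y) (-‿cong (∣∣-signed s 0≤x)))) x≤y)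

  -- Minimal points are empty.

  module Minimal {P : Point} (P-lattice : IsLatticePoint P) (minimal : IsMinimal P)
                 (s t : Sign) (P∈Q : P ∈Q (s , t)) where

    private
      X Y : Point → Carrier
      X Z = signed s (ξ Z)
      Y Z = signed t (η Z)

      module X = Linear (signed-linear s ξ-linear)
      module Y = Linear (signed-linear t η-linear)

    not-below : ∀ {w} → IsDifference w → ¬ w ≋ 𝟎 → ¬ ExtendedOrder (P ⊕ w) P
    not-below {w} d w≉0 below = minimal (P ⊕ w , lattice-⊕ P-lattice d ,
      (λ (e , f) → w≉0 (by e , by f)) , below)
      where
      by : ∀ {x y} → x + y ≈ x → y ≈ 0#
      by {x} {y} e = trans (solve 2 (λ x y → y := x :+ y :- x) refl x y)
        (trans (+-congʳ e) (-‿inverseʳ x))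

    not-basic : ∀ {w} → IsDifference w → ¬ w ≋ 𝟎 → P ⊕ w ∈Q (s , t) →
                0# ≤ - X w → ¬ 0# ≤ - Y w
    not-basic {w} d w≉0 (0≤X , 0≤Y) X≤0 Y≤0 = not-below d w≉0
      [ inj₁ (lattice-⊕ P-lattice d , P-lattice , (s , t) , (0≤X , 0≤Y) , P∈Q ,
        ∣∣-mono s 0≤X (proj₁ P∈Q) (0≤-cong (by (X.f-⊕ P w)) X≤0) ,
        ∣∣-mono t 0≤Y (proj₂ P∈Q) (0≤-cong (by (Y.f-⊕ P w)) Y≤0)) ]
      where
      by : ∀ {p q w} → q ≈ p + w → - w ≈ p - q
      by {p} {q} {w} e = trans (solve 2 (λ p w → :- w := p :- (p :+ w)) refl p w)
        (+-congˡ (-‿cong (sym e)))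

    module Descending {w : Point} (d : IsDifference w) (0<Xw : 0# < X w) (0<-Yw : 0# < - Y w)
                      (P+w∈Q : P ⊕ w ∈Q (s , t)) (P-w∈Q : P ⊕ ⊝ w ∈Q (s , t)) where

      private
        -- The line through P in direction w is α X + β Y = γ. Both α and β are positive because w
        -- goes up in X and down in Y, and therefore the line cuts the quadrant in a bounded
        -- segment.
        α β γ : Carrier
        α = - Y w
        β = X w
        γ = α * X P + β * Y P

        α⁻¹ = proj₁ (reciprocal 0<-Yw)
        β⁻¹ = proj₁ (reciprocal 0<Xw)
        ½   = proj₁ (reciprocal 0<2)
        0<α⁻¹ = proj₁ (proj₂ (reciprocal 0<-Yw))
        0<β⁻¹ = proj₁ (proj₂ (reciprocal 0<Xw))
        0<½   = proj₁ (proj₂ (reciprocal 0<2))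
        αα⁻¹≈1 = proj₂ (proj₂ (reciprocal 0<-Yw))
        ββ⁻¹≈1 = proj₂ (proj₂ (reciprocal 0<Xw))
        2½≈1   = proj₂ (proj₂ (reciprocal 0<2))

      0≤γ : 0# ≤ γ
      0≤γ = inj₁ 0<-Yw ⟨*⟩ proj₁ P∈Q ⟨+⟩ inj₁ 0<Xw ⟨*⟩ proj₂ P∈Q

      w≉0 : ¬ w ≋ 𝟎
      w≉0 w≋0 = 0≮0 (trans (X.f-cong w≋0) (signed-0 s)) 0<Xw

      line : Line
      line = record
        -- The signs of the quadrant move from the coordinates to the coefficients, since a `Line`
        -- is an equation in ξ and η.
        { α = signed s α ; β = signed t β ; γ = γ
        ; nontrivial = λ (α≈0 , _) → 0≮0 (begin
            α                      ≈⟨ signed-involutive s α ⟨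
            signed s (signed s α)  ≈⟨ signed-cong s α≈0 ⟩
            signed s 0#            ≈⟨ signed-0 s ⟩
            0#                     ∎) 0<-Yw
        }

      line-equation : ∀ Z → signed s α * ξ Z + signed t β * η Z ≈ α * X Z + β * Y Z
      line-equation Z = +-cong (signed-* s α (ξ Z)) (signed-* t β (η Z))

      P∈line : P ∈L line
      P∈line = line-equation P

      P+w∈line : P ⊕ w ∈L line
      P+w∈line = trans (line-equation (P ⊕ w))
        (trans (+-cong (*-congˡ (X.f-⊕ P w)) (*-congˡ (Y.f-⊕ P w)))
          (solve 4 (λ a b x y → (:- b) :* (x :+ a) :+ a :* (y :+ b) := (:- b) :* x :+ a :* y)
            refl (X w) (Y w) (X P) (Y P)))

      P-w∈line : P ⊕ ⊝ w ∈L line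
      P-w∈line = trans (line-equation (P ⊕ ⊝ w))
        (trans (+-cong (*-congˡ (X.f-⊖ P w)) (*-congˡ (Y.f-⊖ P w)))
          (solve 4 (λ a b x y → (:- b) :* (x :- a) :+ a :* (y :- b) := (:- b) :* x :+ a :* y)
            refl (X w) (Y w) (X P) (Y P)))

      lattice-line : IsLatticeLine line
      lattice-line = P , P ⊕ w , P-lattice , lattice-⊕ P-lattice d ,
        (λ (e , f) → w≉0 (by e , by f)) , P∈line , P+w∈line
        where
        by : ∀ {x y} → x ≈ x + y → y ≈ 0#
        by {x} {y} e = trans (solve 2 (λ x y → y := x :+ y :- x) refl x y)
          (trans (+-congʳ (sym e)) (-‿inverseʳ x))

      scale : ∀ {a a⁻¹} x → a * a⁻¹ ≈ 1# → a⁻¹ * (a * x) ≈ x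
      scale {a} {a⁻¹} x aa⁻¹≈1 = begin
        a⁻¹ * (a * x) ≈⟨ solve 3 (λ a i x → i :* (a :* x) := a :* i :* x) refl a a⁻¹ x ⟩
        a * a⁻¹ * x   ≈⟨ *-congʳ aa⁻¹≈1 ⟩
        1# * x        ≈⟨ *-identityˡ x ⟩
        x             ∎

      -- The sum of the intercepts γ / α and γ / β, each of which bounds one coordinate on the
      -- segment.
      radius : Carrier
      radius = α⁻¹ * γ + β⁻¹ * γ

      bounded : IsBounded (Section line (s , t))
      bounded = radius , λ Z (Z∈line , 0≤XZ , 0≤YZ) →
        let e = trans (sym (line-equation Z)) Z∈line in
        0≤-⇒≤ (0≤-cong (+-congˡ (-‿cong (trans (scale (X Z) αα⁻¹≈1) (sym (∣∣-signed s 0≤XZ)))))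
          (0≤-cong (first e) (inj₁ 0<α⁻¹ ⟨*⟩ (inj₁ 0<Xw ⟨*⟩ 0≤YZ) ⟨+⟩ inj₁ 0<β⁻¹ ⟨*⟩ 0≤γ))) ,
        0≤-⇒≤ (0≤-cong (+-congˡ (-‿cong (trans (scale (Y Z) ββ⁻¹≈1) (sym (∣∣-signed t 0≤YZ)))))
          (0≤-cong (second e) (inj₁ 0<β⁻¹ ⟨*⟩ (inj₁ 0<-Yw ⟨*⟩ 0≤XZ) ⟨+⟩ inj₁ 0<α⁻¹ ⟨*⟩ 0≤γ)))
        where
        first : ∀ {x y} → α * x + β * y ≈ γ →
                α⁻¹ * (β * y) + β⁻¹ * γ ≈ radius - α⁻¹ * (α * x)
        first {x} {y} e = trans
          (solve 4 (λ i u v z → i :* v :+ z := i :* (u :+ v) :+ z :- i :* u) refl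
            α⁻¹ (α * x) (β * y) (β⁻¹ * γ))
          (+-congʳ (+-congʳ (*-congˡ e)))

        second : ∀ {x y} → α * x + β * y ≈ γ →
                 β⁻¹ * (α * x) + α⁻¹ * γ ≈ radius - β⁻¹ * (β * y)
        second {x} {y} e = trans
          (solve 4 (λ i u v z → i :* u :+ z := z :+ i :* (u :+ v) :- i :* v) refl
            β⁻¹ (α * x) (β * y) (α⁻¹ * γ))
          (+-congʳ (+-congˡ (*-congˡ e)))

      -- The midpoint of the segment between the axes: for a fixed sum γ the product of α X and β Y
      -- is largest when both equal γ / 2.
      M₁ M₂ : Carrier
      M₁ = α⁻¹ * (γ * ½)
      M₂ = β⁻¹ * (γ * ½)

      M : Point
      M = signed s M₁ , signed t M₂

      XM≈ : X M ≈ M₁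
      XM≈ = signed-involutive s M₁

      YM≈ : Y M ≈ M₂
      YM≈ = signed-involutive t M₂

      M∈line : M ∈L line
      M∈line = begin
        signed s α * ξ M + signed t β * η M      ≈⟨ line-equation M ⟩
        α * X M + β * Y M                        ≈⟨ +-cong (*-congˡ XM≈) (*-congˡ YM≈) ⟩
        α * M₁ + β * M₂
          ≈⟨ solve 6 (λ a b i j g h → a :* (i :* (g :* h)) :+ b :* (j :* (g :* h)) :=
               i :* (a :* (g :* h)) :+ j :* (b :* (g :* h))) refl α β α⁻¹ β⁻¹ γ ½ ⟩
        α⁻¹ * (α * (γ * ½)) + β⁻¹ * (β * (γ * ½))
          ≈⟨ +-cong (scale _ αα⁻¹≈1) (scale _ ββ⁻¹≈1) ⟩
        γ * ½ + γ * ½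
          ≈⟨ solve 2 (λ g h → g :* h :+ g :* h := h :* (con (+ 2) :* g)) refl γ ½ ⟩
        ½ * (fromℕ 2 * γ)                        ≈⟨ scale γ 2½≈1 ⟩
        γ                                        ∎

      M∈section : Section line (s , t) M
      M∈section = M∈line ,
        0≤-cong (sym XM≈) (inj₁ 0<α⁻¹ ⟨*⟩ (0≤γ ⟨*⟩ inj₁ 0<½)) ,
        0≤-cong (sym YM≈) (inj₁ 0<β⁻¹ ⟨*⟩ (0≤γ ⟨*⟩ inj₁ 0<½))

      -- With u = α X Z and v = β Y Z, u + v = γ: the defect is
      -- (αβ)⁻¹ ((u + v)² / 4 - u v) = (αβ)⁻¹ ((u - v) / 2)².
      M-maximum : IsMaximumPoint (Section line (s , t)) M
      M-maximum = M∈section , λ Z (Z∈line , 0≤XZ , 0≤YZ) → 0≤-⇒≤ (0≤-cong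
        (sym (+-cong
          (trans (∣∣-product s t (proj₁ (proj₂ M∈section)) (proj₂ (proj₂ M∈section)))
            (*-cong XM≈ YM≈))
          (-‿cong (∣∣-product s t 0≤XZ 0≤YZ))))
        (0≤-cong (defect (X Z) (Y Z) (trans (sym (line-equation Z)) Z∈line))
          (inj₁ 0<α⁻¹ ⟨*⟩ inj₁ 0<β⁻¹ ⟨*⟩ 0≤x² ((α * X Z - β * Y Z) * ½))))
        where
        defect : ∀ x y → α * x + β * y ≈ γ →
          α⁻¹ * β⁻¹ * ((α * x - β * y) * ½ * ((α * x - β * y) * ½)) ≈ M₁ * M₂ - x * y
        defect x y e = begin
          α⁻¹ * β⁻¹ * ((α * x - β * y) * ½ * ((α * x - β * y) * ½))
            ≈⟨ solve 5 (λ i j u v h → i :* j :* ((u :- v) :* h :* ((u :- v) :* h)) :=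
                 i :* ((u :+ v) :* h) :* (j :* ((u :+ v) :* h))
                   :- h :* (con (+ 2) :* (h :* (con (+ 2) :* ((i :* u) :* (j :* v)))))) refl
                 α⁻¹ β⁻¹ (α * x) (β * y) ½ ⟩
          α⁻¹ * ((α * x + β * y) * ½) * (β⁻¹ * ((α * x + β * y) * ½))
            - ½ * (fromℕ 2 * (½ * (fromℕ 2 * ((α⁻¹ * (α * x)) * (β⁻¹ * (β * y))))))
            ≈⟨ +-cong (*-cong (*-congˡ (*-congʳ e)) (*-congˡ (*-congʳ e)))
                 (-‿cong (trans (scale _ 2½≈1) (trans (scale _ 2½≈1)
                   (*-cong (scale x αα⁻¹≈1) (scale y ββ⁻¹≈1))))) ⟩
          M₁ * M₂ - x * y ∎

      -- The point P + z would be smaller than P in the line order: (P + z - M)·(P - M) = |P - M|² +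
      -- (P - M)·z gives the same side, and |P + z - M|² - |P - M|² = |z|² + 2 (P - M)·z gives the
      -- greater distance.
      outward : ∀ {z} → IsDifference z → ¬ z ≋ 𝟎 → 0# < ξ z * ξ z + η z * η z →
                P ⊕ z ∈Q (s , t) → P ⊕ z ∈L line → ¬ 0# ≤ dot (P ⊖ M) z
      outward {z} z-difference z≉0 0<∣z∣² P+z∈Q P+z∈line 0≤dot = not-below z-difference z≉0
        [ inj₂ (record
          { P-lattice = lattice-⊕ P-lattice z-difference
          ; Q-lattice = P-lattice
          ; line = line ; lattice-line = lattice-line ; quadrant = s , t ; bounded = bounded
          ; P-on = P+z∈line , P+z∈Q
          ; Q-on = P∈line , P∈Q
          ; M = M ; M-maximum = M-maximum
          ; same-side = 0≤-cong
              (solve 6 (λ p q x y m n →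
                ((p :- m) :* (p :- m) :+ (q :- n) :* (q :- n)) :+ ((p :- m) :* x :+ (q :- n) :* y)
                := (p :+ x :- m) :* (p :- m) :+ (q :+ y :- n) :* (q :- n)) refl
                (ξ P) (η P) (ξ z) (η z) (ξ M) (η M))
              ((0≤x² (ξ P - ξ M) ⟨+⟩ 0≤x² (η P - η M)) ⟨+⟩ 0≤dot)
          ; farther = 0<-⇒< (<-respʳ-≈
              (solve 6 (λ p q x y m n →
                x :* x :+ y :* y :+ (((p :- m) :* x :+ (q :- n) :* y)
                  :+ ((p :- m) :* x :+ (q :- n) :* y))
                := ((p :+ x :- m) :* (p :+ x :- m) :+ (q :+ y :- n) :* (q :+ y :- n))
                   :- ((p :- m) :* (p :- m) :+ (q :- n) :* (q :- n))) refl
                (ξ P) (η P) (ξ z) (η z) (ξ M) (η M))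
              (0<+0≤ 0<∣z∣² (0≤dot ⟨+⟩ 0≤dot)))
          }) ]

      0<∣w∣² : 0# < ξ w * ξ w + η w * η w
      0<∣w∣² = 0<+0≤ (<-respʳ-≈ (signed-square s (ξ w)) (*-positive 0<Xw 0<Xw)) (0≤x² (η w))

      -- Of the two directions w and -w, one does not lead back towards M, and the sign of (P - M)·w
      -- tells which. If P is M itself, either would do, because the sides are closed.
      impossible : ⊥
      impossible with sign? (dot (P ⊖ M) w)
      ... | inj₁ 0≤dot = outward d w≉0 0<∣w∣² P+w∈Q P+w∈line 0≤dot
      ... | inj₂ dot<0 = outward (difference-⊝ d)
        (⊝-≉0 w≉0)
        (<-respʳ-≈ (sym (+-cong (signed-square Sign.- _) (signed-square Sign.- _))) 0<∣w∣²)
        P-w∈Q P-w∈line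
        (0≤-cong (solve 4 (λ x y u v → :- (x :* u :+ y :* v) := x :* (:- u) :+ y :* (:- v)) refl
          (ξ P - ξ M) (η P - η M) (ξ w) (η w)) (inj₁ dot<0))

    -- Each coordinate of w is at most the distance of P from the corresponding axis, so the step
    -- from P by w crosses neither axis.
    inside : ∀ {w} → Within false P w → Within true P w → P ⊕ w ∈Q (s , t)
    inside {w} ξ-within η-within =
      0≤-cong (sym (X.f-⊕ P w)) (by s (proj₁ P∈Q) ξ-within) ,
      0≤-cong (sym (Y.f-⊕ P w)) (by t (proj₂ P∈Q) η-within)
      where
      by : ∀ r {p z} → 0# ≤ signed r p → 0# ≤ p * p - z * z → 0# ≤ signed r p + signed r z
      by r {p} {z} 0≤p z²≤p² = 0≤-cong (+-congˡ (-‿involutive (signed r z)))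
        (square-cancel 0≤p (0≤-cong (sym (+-cong (signed-square r p)
          (-‿cong (trans (signed-square Sign.- (signed r z)) (signed-square r z))))) z²≤p²))

    within-⊝ : ∀ {p z} → 0# ≤ p * p - z * z → 0# ≤ p * p - (- z) * (- z)
    within-⊝ {p} {z} = 0≤-cong (+-congˡ (-‿cong (sym (signed-square Sign.- z))))

    not-within₊ : ∀ {w} → IsDifference w → ¬ w ≋ 𝟎 → 0# ≤ X w →
                 Within false P w → ¬ Within true P w
    not-within₊ {w} d w≉0 0≤Xw ξ-within η-within with sign? (Y w) | 0≤Xw
    ... | inj₁ 0≤Yw | _ = not-basic (difference-⊝ d) (⊝-≉0 w≉0)
          (inside (within-⊝ ξ-within) (within-⊝ η-within))
          (0≤-cong (trans (sym (-‿involutive _)) (-‿cong (sym (X.f-⊝ w)))) 0≤Xw)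
          (0≤-cong (trans (sym (-‿involutive _)) (-‿cong (sym (Y.f-⊝ w)))) 0≤Yw)
    ... | inj₂ 0<-Yw | inj₁ 0<Xw = Descending.impossible d 0<Xw 0<-Yw
          (inside ξ-within η-within) (inside (within-⊝ ξ-within) (within-⊝ η-within))
    -- Here w is parallel to an axis and its line meets the quadrant in a ray, so the line order
    -- says nothing; but P + w is below P in the basic order.
    ... | inj₂ 0<-Yw | inj₂ 0≈Xw = not-basic d w≉0 (inside ξ-within η-within)
          (inj₂ (trans (sym -0#≈0#) (-‿cong 0≈Xw))) (inj₁ 0<-Yw)

    not-within : ∀ {w} → IsDifference w → ¬ w ≋ 𝟎 → Within false P w → ¬ Within true P w
    not-within {w} d w≉0 ξ-within η-within with sign? (X w)
    ... | inj₁ 0≤Xw  = not-within₊ d w≉0 0≤Xw ξ-within η-within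
    ... | inj₂ 0<-Xw = not-within₊ (difference-⊝ d) (⊝-≉0 w≉0)
          (0≤-cong (sym (X.f-⊝ w)) (inj₁ 0<-Xw)) (within-⊝ ξ-within) (within-⊝ η-within)

    empty : Empty P
    empty w d ξ-within η-within with ξ w ≟ 0# | η w ≟ 0#
    ... | yes ξ≈0 | yes η≈0 = ξ≈0 , η≈0
    ... | no ξ≉0  | _       = ⊥-elim (not-within d (λ (e , _) → ξ≉0 e) ξ-within η-within)
    ... | yes _   | no η≉0  = ⊥-elim (not-within d (λ (_ , f) → η≉0 f) ξ-within η-within)

  -- Lattice bases, and divided cells seen from a corner.

  module Nondegenerate (det≉0 : ¬ (a₀ * b₁ - a₁ * b₀ ≈ 0#)) where

    -- A coordinate that vanishes on `e₁` and `e₂` is a zero row of the matrix of Φ.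
    some-coordinate≉0 : ∀ i → ¬ (∀ w → IsDifference w → coordinate i w ≈ 0#)
    some-coordinate≉0 i vanish = det≉0 (det≈0 i (vanish e₁ e₁-difference) (vanish e₂ e₂-difference))
      where
      det≈0 : ∀ i → coordinate i e₁ ≈ 0# → coordinate i e₂ ≈ 0# → a₀ * b₁ - a₁ * b₀ ≈ 0#
      det≈0 false a₀≈0 b₀≈0 = trans (+-cong (*-congʳ a₀≈0) (-‿cong (*-congˡ b₀≈0)))
        (solve 2 (λ x y → con (+ 0) :* x :- y :* con (+ 0) := con (+ 0)) refl b₁ a₁)
      det≈0 true a₁≈0 b₁≈0 = trans (+-cong (*-congˡ b₁≈0) (-‿cong (*-congʳ a₁≈0)))
        (solve 2 (λ x y → x :* con (+ 0) :- con (+ 0) :* y := con (+ 0)) refl a₀ b₀)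

    -- Expressing `e₁` and `e₂` by u and v factors the determinant of Φ through the determinant of
    -- (u , v), which is therefore nonzero. Cramer's rule then shows that a vanishing combination
    -- has zero coefficients.
    spanning⇒basis : ∀ {u v} → IsDifference u → IsDifference v →
      (∀ w → IsDifference w → ∃[ m ] ∃[ n ] w ≋ m ⊛ u ⊕ n ⊛ v) → IsBasis u v
    spanning⇒basis {u} {v} du dv span = record
      { u-difference = du ; v-difference = dv ; spanning = span
      ; independent  = λ m n (e , f) →
          fromℤ-injective₀ m (*-cancel₀ uv≉0 (begin
            fromℤ m * (ξ u * η v - ξ v * η u)
              ≈⟨ solve 6 (λ m n u v u′ v′ → m :* (u :* v′ :- v :* u′) :=
                   (m :* u :+ n :* v) :* v′ :- v :* (m :* u′ :+ n :* v′)) refl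
                   (fromℤ m) (fromℤ n) (ξ u) (ξ v) (η u) (η v) ⟩
            (fromℤ m * ξ u + fromℤ n * ξ v) * η v - ξ v * (fromℤ m * η u + fromℤ n * η v)
              ≈⟨ +-cong (*-congʳ e) (-‿cong (*-congˡ f)) ⟩
            0# * η v - ξ v * 0#
              ≈⟨ solve 2 (λ x y → con (+ 0) :* x :- y :* con (+ 0) := con (+ 0)) refl (η v) (ξ v) ⟩
            0# ∎)) ,
          fromℤ-injective₀ n (*-cancel₀ uv≉0 (begin
            fromℤ n * (ξ u * η v - ξ v * η u)
              ≈⟨ solve 6 (λ m n u v u′ v′ → n :* (u :* v′ :- v :* u′) :=
                   u :* (m :* u′ :+ n :* v′) :- (m :* u :+ n :* v) :* u′) refl
                   (fromℤ m) (fromℤ n) (ξ u) (ξ v) (η u) (η v) ⟩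
            ξ u * (fromℤ m * η u + fromℤ n * η v) - (fromℤ m * ξ u + fromℤ n * ξ v) * η u
              ≈⟨ +-cong (*-congˡ f) (-‿cong (*-congʳ e)) ⟩
            ξ u * 0# - 0# * η u
              ≈⟨ solve 2 (λ x y → x :* con (+ 0) :- con (+ 0) :* y := con (+ 0)) refl (ξ u) (η u) ⟩
            0# ∎))
      }
      where
      uv≉0 : ¬ ξ u * η v - ξ v * η u ≈ 0#
      uv≉0 uv≈0 =
        let m , n , x₁ , y₁ = span e₁ e₁-difference
            r , s , x₂ , y₂ = span e₂ e₂-difference
        in det≉0 (begin
          a₀ * b₁ - a₁ * b₀
            ≈⟨ +-cong (*-cong x₁ y₂) (-‿cong (*-cong y₁ x₂)) ⟩
          _ ≈⟨ solve 8 (λ m n r s u v u′ v′ →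
                 (m :* u :+ n :* v) :* (r :* u′ :+ s :* v′)
                   :- (m :* u′ :+ n :* v′) :* (r :* u :+ s :* v)
                 := (m :* s :- n :* r) :* (u :* v′ :- v :* u′)) refl
                 (fromℤ m) (fromℤ n) (fromℤ r) (fromℤ s) (ξ u) (ξ v) (η u) (η v) ⟩
          (fromℤ m * fromℤ s - fromℤ n * fromℤ r) * (ξ u * η v - ξ v * η u)
            ≈⟨ *-congˡ uv≈0 ⟩
          (fromℤ m * fromℤ s - fromℤ n * fromℤ r) * 0#
            ≈⟨ zeroʳ _ ⟩
          0# ∎)

    -- The first four integers make the new vectors differences of lattice points, and the last four
    -- recover the old vectors, so that the new ones span.
    basis-change : ∀ {u v u′ v′} → IsBasis u v → ∀ i j k l p q r s →
      u′ ≋ i ⊛ u ⊕ j ⊛ v → v′ ≋ k ⊛ u ⊕ l ⊛ v →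
      u ≋ p ⊛ u′ ⊕ q ⊛ v′ → v ≋ r ⊛ u′ ⊕ s ⊛ v′ → IsBasis u′ v′
    basis-change B i j k l p q r s u′≋ v′≋ u≋ v≋ = spanning⇒basis
      (difference-combination i j u-difference v-difference u′≋)
      (difference-combination k l u-difference v-difference v′≋)
      (λ w d → let m , n , w≋ = spanning w d in
        m ℤ.* p ℤ.+ n ℤ.* r , m ℤ.* q ℤ.+ n ℤ.* s , substitute m n p q r s w≋ u≋ v≋)
      where open IsBasis B

    -- The vectors g and h point from the neighbouring vertices to A, that is, out of the cell. So
    -- points beyond A have natural numbers as coefficients.
    record Corner (φ : Frame) (A g h : Point) : Set (c ⊔ ℓ₁ ⊔ ℓ₂) where
      field
        A-lattice : IsLatticePoint A
        basis     : IsBasis g h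
        divided   : Divided (horizontal φ A) (vertical φ A) (horizontal φ g) (vertical φ g)
                            (horizontal φ h) (vertical φ h)

      open IsBasis basis public
        renaming (u-difference to g-difference; v-difference to h-difference)
      open Divided divided public

    swap : Frame → Frame
    swap (i , s , t) = not i , t , s

    basis-swap : ∀ {u v} → IsBasis u v → IsBasis v u
    basis-swap {u} {v} B = basis-change B (+ 0) (+ 1) (+ 1) (+ 0) (+ 0) (+ 1) (+ 1) (+ 0)
      (pick₂ u v) (pick₁ u v) (pick₂ v u) (pick₁ v u)

    Corner-swap : ∀ φ {A g h} → Corner φ A g h → Corner (swap φ) A h g
    -- Splitting on the flag makes `not (not i)` reduce, so that the vertical axis of the swapped
    -- frame is the old horizontal one.
    Corner-swap (false , s , t) C = record
      { A-lattice = A-lattice ; basis = basis-swap basis ; divided = Divided-swap divided }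
      where open Corner C
    Corner-swap (true , s , t) C = record
      { A-lattice = A-lattice ; basis = basis-swap basis ; divided = Divided-swap divided }
      where open Corner C

    position-swap : ∀ {P} A g h m n → P ≋ A ⊕ m ⊛ g ⊕ n ⊛ h → P ≋ A ⊕ n ⊛ h ⊕ m ⊛ g
    position-swap A g h m n P≋ = ≋-trans P≋ (by _ _ _ , by _ _ _)
      where
      by : ∀ x y z → x + y + z ≈ x + z + y
      by = solve 3 (λ x y z → x :+ y :+ z := x :+ z :+ y) refl

    Corner-reflect : ∀ i s t {A g h} → Corner (i , s , t) A g h →
                     Corner (i , s , Sign.opposite t) (A ⊖ h) g (⊝ h)
    Corner-reflect i s t {A} {g} {h} C = record
      { A-lattice = lattice-⊖ A-lattice h-difference
      ; basis = basis-change basis (+ 1) (+ 0) (+ 0) -[1+ 0 ] (+ 1) (+ 0) (+ 0) -[1+ 0 ]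
          (pick₁ g h) (⊝-combination₂ g h) (pick₁ g (⊝ h))
          (≋-trans (⊝-involutive h) (⊝-combination₂ g (⊝ h)))
      ; divided = Divided-cong (sym (X.f-⊖ A h))
          (sym (trans (signed-opposite t _) (-‿cong (Y.f-⊖ A h))))
          refl (sym (signed-opposite t _)) (sym (X.f-⊝ h))
          (sym (trans (signed-opposite t _) (-‿cong (Y.f-⊝ h))))
          (Divided-reflect divided)
      }
      where
      open Corner C
      module X = Linear (horizontal-linear (i , s , t))
      module Y = Linear (vertical-linear (i , s , t))

    -- The vertex A - h takes over as corner when P lies on its side of the cell.
    Corner-face : ∀ i s t {A g h P} m n → Corner (i , s , t) A g h → P ≋ A ⊕ m ⊛ g ⊕ n ⊛ h →
      ∃[ t′ ] ∃[ A′ ] ∃[ h′ ] ∃[ k ]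
        (Corner (i , s , t′) A′ g h′ × P ≋ A′ ⊕ m ⊛ g ⊕ (+ k) ⊛ h′ ×
         (∀ j → coordinate j h′ * coordinate j h′ ≈ coordinate j h * coordinate j h))
    Corner-face i s t {A} {g} {h} m (+ k) C P≋ = t , A , h , k , C , P≋ , λ _ → refl
    -- The first of the 1 + k steps along -h leads to the new corner A - h, which leaves k steps.
    Corner-face i s t {A} {g} {h} m -[1+ k ] C P≋ =
      Sign.opposite t , A ⊖ h , ⊝ h , k , Corner-reflect i s t C ,
      ≋-trans P≋ (by _ _ _ , by _ _ _) , squares
      where
      by : ∀ x y z → x + y + fromℤ -[1+ k ] * z ≈ x - z + y + fromℕ k * - z
      by x y z = trans (+-congˡ (*-congʳ (-‿cong (fromℕ-+ 1 k))))
        (solve 4 (λ x y z k → x :+ y :+ (:- (con (+ 1) :+ k)) :* z :=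
                              x :- z :+ y :+ k :* (:- z)) refl x y z (fromℕ k))

      squares : ∀ j → coordinate j (⊝ h) * coordinate j (⊝ h) ≈ coordinate j h * coordinate j h
      squares false = signed-square Sign.- _
      squares true  = signed-square Sign.- _

    Corner-turn : ∀ φ {A g h} → Corner φ A g h → 0# < - vertical φ g →
      ∃[ k ] ∃[ m ] Corner φ (A ⊕ (+ k) ⊛ g) (h ⊕ (+ m) ⊛ g) (⊝ g)
    Corner-turn φ {A} {g} {h} C g-descends =
      let k , m , D = Divided-turn (Corner.divided C) g-descends in k , m , turned k m D
      where
      open Corner C using (A-lattice; basis; g-difference; h-difference)
      module X = Linear (horizontal-linear φ)
      module Y = Linear (vertical-linear φ)

      by₀ : ∀ k x y → k * x ≈ k * x + fromℤ (+ 0) * y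
      by₀ = solve 3 (λ k x y → k :* x := k :* x :+ con (+ 0) :* y) refl

      by₁ : ∀ m x y → y + m * x ≈ m * x + fromℤ (+ 1) * y
      by₁ = solve 3 (λ m x y → y :+ m :* x := m :* x :+ con (+ 1) :* y) refl

      by₂ : ∀ m x y → x ≈ fromℤ (+ 0) * (y + m * x) + fromℤ -[1+ 0 ] * - x
      by₂ = solve 3 (λ m x y → x := con (+ 0) :* (y :+ m :* x) :+ con -[1+ 0 ] :* (:- x)) refl

      by₃ : ∀ m x y → y ≈ fromℤ (+ 1) * (y + m * x) + m * - x
      by₃ = solve 3 (λ m x y → y := con (+ 1) :* (y :+ m :* x) :+ m :* (:- x)) refl

      turned : ∀ k m → Divided (horizontal φ A + fromℕ k * horizontal φ g)
                               (vertical φ A + fromℕ k * vertical φ g)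
                               (horizontal φ h + fromℕ m * horizontal φ g)
                               (vertical φ h + fromℕ m * vertical φ g)
                               (- horizontal φ g) (- vertical φ g) →
               Corner φ (A ⊕ (+ k) ⊛ g) (h ⊕ (+ m) ⊛ g) (⊝ g)
      turned k m D = record
        { A-lattice = lattice-⊕ A-lattice
            (difference-combination (+ k) (+ 0) g-difference h-difference (by₀ _ _ _ , by₀ _ _ _))
        -- The matrix with rows (m , 1) and (-1 , 0) has determinant 1; the rows of its inverse are
        -- (0 , -1) and (1 , m).
        ; basis = basis-change basis (+ m) (+ 1) -[1+ 0 ] (+ 0) (+ 0) -[1+ 0 ] (+ 1) (+ m)
            (by₁ _ _ _ , by₁ _ _ _) (⊝-combination g h)
            (by₂ _ _ _ , by₂ _ _ _) (by₃ _ _ _ , by₃ _ _ _)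
        ; divided = Divided-cong
            (sym (trans (X.f-⊕ A _) (+-congˡ (X.f-⊛ (+ k) g))))
            (sym (trans (Y.f-⊕ A _) (+-congˡ (Y.f-⊛ (+ k) g))))
            (sym (trans (X.f-⊕ h _) (+-congˡ (X.f-⊛ (+ m) g))))
            (sym (trans (Y.f-⊕ h _) (+-congˡ (Y.f-⊛ (+ m) g))))
            (sym (X.f-⊝ g)) (sym (Y.f-⊝ g))
            D
        }

    -- The coefficient b survives because h occurs once in h + m g. The coefficient of -g collects
    -- the remaining copies of g and may be negative, which `Corner-face` repairs.
    position-turn : ∀ {P} A g h a b k m → P ≋ A ⊕ (+ a) ⊛ g ⊕ (+ b) ⊛ h →
      P ≋ A ⊕ (+ k) ⊛ g ⊕ (+ b) ⊛ (h ⊕ (+ m) ⊛ g) ⊕ (+ (k ℕ.+ b ℕ.* m) ℤ.- + a) ⊛ (⊝ g)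
    position-turn A g h a b k m P≋ = ≋-trans P≋ (by _ _ _ , by _ _ _)
      where
      number : fromℤ (+ (k ℕ.+ b ℕ.* m) ℤ.- + a) ≈ fromℕ k + fromℕ b * fromℕ m - fromℕ a
      number = trans (fromℤ-+ (+ (k ℕ.+ b ℕ.* m)) (ℤ.- + a))
        (+-cong (trans (fromℕ-+ k (b ℕ.* m)) (+-congˡ (fromℕ-* b m))) (fromℤ-neg (+ a)))

      by : ∀ x g h → x + fromℕ a * g + fromℕ b * h ≈
           x + fromℕ k * g + fromℕ b * (h + fromℕ m * g)
             + fromℤ (+ (k ℕ.+ b ℕ.* m) ℤ.- + a) * - g
      by x g h = trans
        (solve 7 (λ x g h a b k m → x :+ a :* g :+ b :* h :=
           x :+ k :* g :+ b :* (h :+ m :* g) :+ (k :+ b :* m :- a) :* (:- g)) refl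
           x g h (fromℕ a) (fromℕ b) (fromℕ k) (fromℕ m))
        (+-congˡ (*-congʳ (sym number)))

    exceeds-g : ∀ φ {A g h P a b} → Corner φ A g h → P ≋ A ⊕ (+ a) ⊛ g ⊕ (+ b) ⊛ h → b ℕ.< a →
                0# ≤ horizontal φ P - horizontal φ g
    exceeds-g φ {A} {g} {h} {a = a} {b} C P≋ b<a = exceeds-side 0≤x 0≤g₁ 0≤g₁+h₁ b<a
      (Linear.f-position (horizontal-linear φ) A g h (+ a) (+ b) P≋)
      where open Corner C

    exceeds-h : ∀ φ {A g h P a b} → Corner φ A g h → P ≋ A ⊕ (+ a) ⊛ g ⊕ (+ b) ⊛ h → a ℕ.< b →
                0# ≤ vertical φ P - vertical φ h
    exceeds-h φ {A} {g} {h} {a = a} {b} C P≋ a<b =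
      exceeds-side 0≤y 0≤h₂ (0≤-cong (+-comm _ _) 0≤g₂+h₂) a<b
      (Linear.f-position (vertical-linear φ) A h g (+ b) (+ a) (position-swap A g h (+ a) (+ b) P≋))
      where open Corner C

    -- The descent.

    Located : Point → ℕ → ℕ → Set (c ⊔ ℓ₁ ⊔ ℓ₂)
    Located P a b = ∃[ φ ] ∃[ A ] ∃[ g ] ∃[ h ]
      (Corner φ A g h × P ≋ A ⊕ (+ a) ⊛ g ⊕ (+ b) ⊛ h)

    Located-swap : ∀ {P a b} → Located P a b → Located P b a
    Located-swap {a = a} {b} (φ , A , g , h , C , P≋) =
      swap φ , A , h , g , Corner-swap φ C , position-swap A g h (+ a) (+ b) P≋

    g-within : ∀ i s t {A g h P a b} → Corner (i , s , t) A g h →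
               P ≋ A ⊕ (+ a) ⊛ g ⊕ (+ b) ⊛ h → b ℕ.< a → Within i P g
    g-within i s t C P≋ b<a =
      within i s (Corner.0≤g₁ C) (exceeds-g (i , s , t) C P≋ b<a)

    -- P lies beyond g in the first coordinate, hence not in the second one.
    g-descends : ∀ i s t {A g h P a b} → Empty P → Corner (i , s , t) A g h →
                 P ≋ A ⊕ (+ a) ⊛ g ⊕ (+ b) ⊛ h → b ℕ.< a → 0# < - vertical (i , s , t) g
    g-descends i s t {A} {g} {h} {a = a} {b} empty C P≋ b<a =
      [ (λ 0≤g₂ → ⊥-elim (basis-≉0ˡ basis (Empty-within empty i g-difference
          (g-within i s t C P≋ b<a)
          (within (not i) t 0≤g₂ (exceeds-side 0≤y 0≤g₂ 0≤g₂+h₂ b<a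
            (Linear.f-position (vertical-linear (i , s , t)) A g h (+ a) (+ b) P≋))))))
      , (λ 0<-g₂ → 0<-g₂) ]′ (sign? (vertical (i , s , t) g))
      where open Corner C

    -- In the descent z is the side g of the old cell, which has become h up to signs in the new
    -- one. The old cell bounds its first coordinate by that of P; if b < c, the new cell would
    -- bound its second coordinate as well, against emptiness.
    h-steps-bounded : ∀ i s t {A g h z P b c} → Empty P → Corner (i , s , t) A g h →
      P ≋ A ⊕ (+ b) ⊛ g ⊕ (+ c) ⊛ h → IsDifference z → ¬ z ≋ 𝟎 → Within i P z →
      coordinate (not i) h * coordinate (not i) h ≈ coordinate (not i) z * coordinate (not i) z →
      c ℕ.≤ b
    h-steps-bounded i s t empty C P≋ z-difference z≉0 z-within h²≈z² = ℕₚ.≮⇒≥ λ b<c →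
      z≉0 (Empty-within empty i z-difference z-within
        (0≤-cong (+-congˡ (-‿cong h²≈z²))
          (within (not i) t (Corner.0≤h₂ C) (exceeds-h (i , s , t) C P≋ b<c))))

    descend : ∀ {P a b} → Empty P → Located P a b → b ℕ.< a →
              ∃[ c ] (c ℕ.≤ b × Located P b c)
    descend {P} {a} {b} empty ((i , s , t) , A , g , h , C , P≋) b<a =
      let k , m , C′ = Corner-turn (i , s , t) C (g-descends i s t empty C P≋ b<a)
          t′ , A′ , h′ , c , C″ , P≋′ , squares = Corner-face i s t (+ b)
            (+ (k ℕ.+ b ℕ.* m) ℤ.- + a) C′ (position-turn A g h a b k m P≋)
      in c , h-steps-bounded i s t′ empty C″ P≋′ g-difference (basis-≉0ˡ basis)
               (g-within i s t C P≋ b<a) (trans (squares (not i)) (⊝-square (not i))) ,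
         (i , s , t′) , A′ , (h ⊕ (+ m) ⊛ g) , h′ , C″ , P≋′
      where
      open Corner C

      ⊝-square : ∀ j → coordinate j (⊝ g) * coordinate j (⊝ g) ≈ coordinate j g * coordinate j g
      ⊝-square false = signed-square Sign.- _
      ⊝-square true  = signed-square Sign.- _

    -- P - (g + h) is A + n (g + h), and both A and g + h have nonnegative coordinates in the frame.
    -- So P bounds g + h in both coordinates.
    diagonal : ∀ {P n} → Empty P → ¬ Located P (suc n) (suc n)
    diagonal {P} {n} empty (φ@(i , s , t) , A , g , h , C , P≋) =
      basis-≉0⊕ basis (Empty-within empty i
        (difference-combination (+ 1) (+ 1) g-difference h-difference (both _ _ , both _ _))
        (within i s (0≤-cong (sym (X.f-⊕ g h)) 0≤g₁+h₁)
          (by (X.f-⊕ g h) 0≤x 0≤g₁+h₁ (X.f-position A g h (+ suc n) (+ suc n) P≋)))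
        (within (not i) t (0≤-cong (sym (Y.f-⊕ g h)) 0≤g₂+h₂)
          (by (Y.f-⊕ g h) 0≤y 0≤g₂+h₂ (Y.f-position A g h (+ suc n) (+ suc n) P≋))))
      where
      open Corner C
      module X = Linear (horizontal-linear φ)
      module Y = Linear (vertical-linear φ)

      both : ∀ x y → x + y ≈ fromℤ (+ 1) * x + fromℤ (+ 1) * y
      both = solve 2 (λ x y → x :+ y := con (+ 1) :* x :+ con (+ 1) :* y) refl

      by : ∀ {p x g h w} → w ≈ g + h → 0# ≤ x → 0# ≤ g + h →
           p ≈ x + fromℕ (suc n) * g + fromℕ (suc n) * h → 0# ≤ p - w
      by {p} {x} {g} {h} {w} w≈ 0≤x 0≤g+h p≈ = 0≤-cong (begin
        x + fromℕ n * (g + h)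
          ≈⟨ solve 4 (λ x g h ν → x :+ ν :* (g :+ h) :=
               x :+ (con (+ 1) :+ ν) :* g :+ (con (+ 1) :+ ν) :* h :- (g :+ h)) refl
               x g h (fromℕ n) ⟩
        x + (fromℕ 1 + fromℕ n) * g + (fromℕ 1 + fromℕ n) * h - (g + h)
          ≈⟨ +-cong (+-cong (+-congˡ (*-congʳ (fromℕ-+ 1 n))) (*-congʳ (fromℕ-+ 1 n)))
                    (-‿cong w≈) ⟨
        x + fromℕ (suc n) * g + fromℕ (suc n) * h - w
          ≈⟨ +-congʳ p≈ ⟨
        p - w ∎) (0≤x ⟨+⟩ fromℕ-nonneg n ⟨*⟩ 0≤g+h)

    -- Every descent lowers the sum of the two numbers.
    reach : ∀ {P} → Empty P → ∀ a b → Acc ℕ._<_ (a ℕ.+ b) → Located P a b → Located P 0 0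
    reach empty a b (acc rec) L with ℕₚ.<-cmp a b
    reach empty zero    zero    _ L | tri≈ _ ≡.refl _ = L
    reach empty (suc n) (suc n) _ L | tri≈ _ ≡.refl _ = ⊥-elim (diagonal {n = n} empty L)
    reach empty a b (acc rec) L | tri> _ _ b<a =
      let c , c≤b , L′ = descend {a = a} {b} empty L b<a
      in reach empty b c (rec (ℕₚ.+-mono-<-≤ b<a c≤b)) L′
    reach empty a b (acc rec) L | tri< a<b _ _ =
      let c , c≤a , L′ = descend {a = b} {a} empty (Located-swap {a = a} {b} L) a<b
      in reach empty a c (rec (ℕₚ.+-monoʳ-< a (ℕₚ.≤-<-trans c≤a a<b))) L′

    -- Translation between corners and divided cells.

    flip : Bool → Sign → Sign
    flip false s = s
    flip true  s = Sign.opposite s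

    -- Moving along g changes just the first sign of the frame, and moving along h just the second,
    -- so the matching of vertices with quadrants is a product of two such bijections.
    flip-↔ : Sign → Bool ↔ Sign
    flip-↔ s = mk↔ₛ′ (λ i → flip i s) (from s) (to∘from s) (from∘to s)
      where
      from : Sign → Sign → Bool
      from Sign.+ Sign.+ = false
      from Sign.+ Sign.- = true
      from Sign.- Sign.+ = true
      from Sign.- Sign.- = false

      to∘from : ∀ s t → flip (from s t) s ≡ t
      to∘from Sign.+ Sign.+ = ≡.refl
      to∘from Sign.+ Sign.- = ≡.refl
      to∘from Sign.- Sign.+ = ≡.refl
      to∘from Sign.- Sign.- = ≡.refl

      from∘to : ∀ s i → from s (flip i s) ≡ i
      from∘to Sign.+ false = ≡.refl
      from∘to Sign.+ true  = ≡.refl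
      from∘to Sign.- false = ≡.refl
      from∘to Sign.- true  = ≡.refl

    basis-⊝ : ∀ {u v} → IsBasis u v → IsBasis (⊝ u) (⊝ v)
    basis-⊝ {u} {v} B = basis-change B -[1+ 0 ] (+ 0) (+ 0) -[1+ 0 ] -[1+ 0 ] (+ 0) (+ 0) -[1+ 0 ]
      (⊝-combination u v) (⊝-combination₂ u v)
      (≋-trans (⊝-involutive u) (⊝-combination (⊝ u) (⊝ v)))
      (≋-trans (⊝-involutive v) (⊝-combination₂ (⊝ u) (⊝ v)))

    Corner⇒vertex : ∀ φ {A g h} → Corner φ A g h → IsVertexOfDividedCell A
    Corner⇒vertex (axis , s , t) {A} {g} {h} C =
      cell , divides axis abscissa ordinate , (false , false) , ≋-refl
      where
      open Corner C

      cell : Cell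
      cell = record { base = A ; base-lattice = A-lattice ; u = ⊝ g ; v = ⊝ h
                    ; basis = basis-⊝ basis }

      module X = Linear (horizontal-linear (axis , s , t))
      module Y = Linear (vertical-linear (axis , s , t))

      far : ∀ {f} → Linear f → f (A ⊕ ⊝ g ⊕ ⊝ h) ≈ f A - f g - f h
      far L = trans (Linear.f-⊖ L (A ⊕ ⊝ g) h) (+-congʳ (Linear.f-⊖ L A g))

      minus : ∀ x y → x - y ≈ - (y - x)
      minus = solve 2 (λ x y → x :- y := :- (y :- x)) refl

      minus₃ : ∀ x g h → g + h - x ≈ - (x - g - h)
      minus₃ = solve 3 (λ x g h → g :+ h :- x := :- (x :- g :- h)) refl

      abscissa : ∀ i j → 0# ≤ signed (flip i s) (coordinate axis (Cell.vertex cell (i , j)))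
      abscissa false false = 0≤x
      abscissa false true  = 0≤-cong (sym (X.f-⊖ A h)) h₁≤x
      abscissa true  false = 0≤-cong (trans (trans (minus _ _) (-‿cong (sym (X.f-⊖ A g))))
        (sym (signed-opposite s _))) x≤g₁
      abscissa true  true  = 0≤-cong
        (trans (trans (minus₃ _ _ _) (-‿cong (sym (far (horizontal-linear (axis , s , t))))))
          (sym (signed-opposite s _))) x≤g₁+h₁

      ordinate : ∀ i j → 0# ≤ signed (flip j t) (coordinate (not axis) (Cell.vertex cell (i , j)))
      ordinate false false = 0≤y
      ordinate true  false = 0≤-cong (sym (Y.f-⊖ A g)) g₂≤y
      ordinate false true  = 0≤-cong (trans (trans (minus _ _) (-‿cong (sym (Y.f-⊖ A h))))
        (sym (signed-opposite t _))) y≤h₂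
      ordinate true  true  = 0≤-cong
        (trans (trans (minus₃ _ _ _) (-‿cong (sym (far (vertical-linear (axis , s , t))))))
          (sym (signed-opposite t _))) y≤g₂+h₂

      divides : ∀ a →
        (∀ i j → 0# ≤ signed (flip i s) (coordinate a (Cell.vertex cell (i , j)))) →
        (∀ i j → 0# ≤ signed (flip j t) (coordinate (not a) (Cell.vertex cell (i , j)))) →
        IsDivided cell
      divides false xs ys = (flip-↔ s ×-↔ flip-↔ t) , λ (i , j) → xs i j , ys i j
      -- When the axes are exchanged, the second bit of a vertex determines the sign of ξ, so the
      -- bits are swapped first.
      divides true  xs ys = ((flip-↔ t ×-↔ flip-↔ s) ↔-∘ ×-comm Bool Bool) ,
        λ (i , j) → ys i j , xs i j

    -- Adjacent quadrants at opposite vertices force the cell into a line.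
    opposite-vertices : ∀ i s {A u v} → IsBasis u v →
      0# ≤ signed s (coordinate i A) → 0# ≤ signed s (coordinate i (A ⊕ u ⊕ v)) →
      0# ≤ - signed s (coordinate i (A ⊕ u)) → ¬ 0# ≤ - signed s (coordinate i (A ⊕ v))
    opposite-vertices i s {A} {u} {v} B 0≤A 0≤A+u+v A+u≤0 A+v≤0 =
      some-coordinate≉0 i (λ w d → let m , n , w≋ = IsBasis.spanning B w d in begin
        coordinate i w                        ≈⟨ Z.f-cong w≋ ⟩
        coordinate i (m ⊛ u ⊕ n ⊛ v)          ≈⟨ Z.f-⊕ _ _ ⟩
        coordinate i (m ⊛ u) + coordinate i (n ⊛ v)
          ≈⟨ +-cong (Z.f-⊛ m u) (Z.f-⊛ n v) ⟩
        fromℤ m * coordinate i u + fromℤ n * coordinate i v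
          ≈⟨ +-cong (*-congˡ (unsigned s (0≤-antisym 0≤u u≤0)))
                    (*-congˡ (unsigned s (0≤-antisym 0≤v v≤0))) ⟩
        fromℤ m * 0# + fromℤ n * 0#
          ≈⟨ solve 2 (λ m n → m :* con (+ 0) :+ n :* con (+ 0) := con (+ 0)) refl
               (fromℤ m) (fromℤ n) ⟩
        0# ∎)
      where
      module Z = Linear (coordinate-linear i)
      module S = Linear (signed-linear s (coordinate-linear i))
      f : Point → Carrier
      f X = signed s (coordinate i X)

      unsigned : ∀ s {x} → signed s x ≈ 0# → x ≈ 0#
      unsigned Sign.+ e = e
      unsigned Sign.- e = trans (sym (-‿involutive _)) (trans (-‿cong e) -0#≈0#)

      A+u≈ : f (A ⊕ u) ≈ f A + f u
      A+u≈ = S.f-⊕ A u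
      A+v≈ : f (A ⊕ v) ≈ f A + f v
      A+v≈ = S.f-⊕ A v
      A+u+v≈ : f (A ⊕ u ⊕ v) ≈ f A + f u + f v
      A+u+v≈ = trans (S.f-⊕ (A ⊕ u) v) (+-congʳ A+u≈)

      -- The step from A to A + u gives f u ≤ 0, and the step from A + v to A + u + v gives 0 ≤ f u;
      -- similarly for v. The coordinate then vanishes on a basis, hence on all differences.
      u≤0 : 0# ≤ - f u
      u≤0 = 0≤-cong (trans (+-congʳ (-‿cong A+u≈))
        (solve 2 (λ x p → :- (x :+ p) :+ x := :- p) refl (f A) (f u))) (A+u≤0 ⟨+⟩ 0≤A)
      v≤0 : 0# ≤ - f v
      v≤0 = 0≤-cong (trans (+-congʳ (-‿cong A+v≈))
        (solve 2 (λ x p → :- (x :+ p) :+ x := :- p) refl (f A) (f v))) (A+v≤0 ⟨+⟩ 0≤A)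
      0≤u : 0# ≤ f u
      0≤u = 0≤-cong (trans (+-cong A+u+v≈ (-‿cong A+v≈))
        (solve 3 (λ x p q → x :+ p :+ q :- (x :+ q) := p) refl (f A) (f u) (f v)))
        (0≤A+u+v ⟨+⟩ A+v≤0)
      0≤v : 0# ≤ f v
      0≤v = 0≤-cong (trans (+-cong A+u+v≈ (-‿cong A+u≈))
        (solve 3 (λ x p q → x :+ p :+ q :- (x :+ p) := q) refl (f A) (f u) (f v)))
        (0≤A+u+v ⟨+⟩ A+u≤0)

    -- With g = -u and h = -v each of the eight inequalities of `Divided` is the sign of one
    -- coordinate at one vertex.
    base-corner : ∀ s t {A u v} → IsLatticePoint A → IsBasis u v → A ∈Q (s , t) →
      0# ≤ - signed s (ξ (A ⊕ u)) × 0# ≤ signed t (η (A ⊕ u)) →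
      0# ≤ signed s (ξ (A ⊕ v)) × 0# ≤ - signed t (η (A ⊕ v)) →
      0# ≤ - signed s (ξ (A ⊕ u ⊕ v)) × 0# ≤ - signed t (η (A ⊕ u ⊕ v)) →
      Corner (false , s , t) A (⊝ u) (⊝ v)
    base-corner s t {A} {u} {v} A-lattice B (0≤x , 0≤y) (u₁ , u₂) (v₁ , v₂) (w₁ , w₂) = record
      { A-lattice = A-lattice
      ; basis = basis-⊝ B
      ; divided = record
        { 0≤x = 0≤x
        ; 0≤y = 0≤y
        ; x≤g₁ = 0≤-cong (below X u) u₁
        ; g₂≤y = 0≤-cong (above Y u) u₂
        ; h₁≤x = 0≤-cong (above X v) v₁
        ; y≤h₂ = 0≤-cong (below Y v) v₂
        ; x≤g₁+h₁ = 0≤-cong (beyond X) w₁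
        ; y≤g₂+h₂ = 0≤-cong (beyond Y) w₂
        }
      }
      where
      X : Linear (λ Z → signed s (ξ Z))
      X = signed-linear s ξ-linear

      Y : Linear (λ Z → signed t (η Z))
      Y = signed-linear t η-linear

      above : ∀ {f} → Linear f → ∀ z → f (A ⊕ z) ≈ f A - f (⊝ z)
      above {f} L z = trans (L.f-⊕ A z) (trans
        (solve 2 (λ x z → x :+ z := x :- (:- z)) refl (f A) (f z))
        (+-congˡ (-‿cong (sym (L.f-⊝ z)))))
        where module L = Linear L

      below : ∀ {f} → Linear f → ∀ z → - f (A ⊕ z) ≈ f (⊝ z) - f A
      below {f} L z = trans (-‿cong (L.f-⊕ A z)) (trans
        (solve 2 (λ x z → :- (x :+ z) := :- z :- x) refl (f A) (f z))
        (+-congʳ (sym (L.f-⊝ z))))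
        where module L = Linear L

      beyond : ∀ {f} → Linear f → - f (A ⊕ u ⊕ v) ≈ f (⊝ u) + f (⊝ v) - f A
      beyond {f} L = trans (-‿cong (trans (L.f-⊕ (A ⊕ u) v) (+-congʳ (L.f-⊕ A u)))) (trans
        (solve 3 (λ x y z → :- (x :+ y :+ z) := :- y :- z :- x) refl (f A) (f u) (f v))
        (+-congʳ (sym (+-cong (L.f-⊝ u) (L.f-⊝ v)))))
        where module L = Linear L

    ≢-≢⇒≡ : ∀ {a b c : Sign} → ¬ a ≡ b → ¬ a ≡ c → b ≡ c
    ≢-≢⇒≡ {_}      {Sign.+} {Sign.+} _   _   = ≡.refl
    ≢-≢⇒≡ {_}      {Sign.-} {Sign.-} _   _   = ≡.refl
    ≢-≢⇒≡ {Sign.+} {Sign.+} {Sign.-} a≢b _   = ⊥-elim (a≢b ≡.refl)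
    ≢-≢⇒≡ {Sign.+} {Sign.-} {Sign.+} _   a≢c = ⊥-elim (a≢c ≡.refl)
    ≢-≢⇒≡ {Sign.-} {Sign.+} {Sign.-} _   a≢c = ⊥-elim (a≢c ≡.refl)
    ≢-≢⇒≡ {Sign.-} {Sign.-} {Sign.+} a≢b _   = ⊥-elim (a≢b ≡.refl)

    signed-≢ : ∀ {s s′ x} → ¬ s ≡ s′ → 0# ≤ signed s′ x → 0# ≤ - signed s x
    signed-≢ {Sign.+} {Sign.+} s≢s′ _ = ⊥-elim (s≢s′ ≡.refl)
    signed-≢ {Sign.+} {Sign.-} _ 0≤-x = 0≤-x
    signed-≢ {Sign.-} {Sign.+} _ 0≤x  = 0≤-cong (sym (-‿involutive _)) 0≤x
    signed-≢ {Sign.-} {Sign.-} s≢s′ _ = ⊥-elim (s≢s′ ≡.refl)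

    -- The given bijection may be any of the 24. Those that put opposite vertices of the cell into
    -- adjacent quadrants are geometrically impossible, and all others differ from the standard one
    -- by a frame.
    IsDivided⇒Corner : ∀ C → IsDivided C → ∃[ φ ] ∃[ A ] ∃[ g ] ∃[ h ] Corner φ A g h
    IsDivided⇒Corner C (σ , member) = classify
      where
      open Cell C
      q : Bool × Bool → Quadrant
      q = Inverse.to σ

      v₀₀ v₁₀ v₀₁ v₁₁ : Bool × Bool
      v₀₀ = false , false
      v₁₀ = true , false
      v₀₁ = false , true
      v₁₁ = true , true

      q₁ q₂ : Bool × Bool → Sign
      q₁ i = proj₁ (q i)
      q₂ i = proj₂ (q i)

      distinct : ∀ {i j} → ¬ i ≡ j → q₁ i ≡ q₁ j → ¬ q₂ i ≡ q₂ j
      distinct {i} {j} i≢j e f = i≢j (≡.trans (≡.sym (Inverse.strictlyInverseʳ σ i))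
        (≡.trans (≡.cong (Inverse.from σ) (≡.cong₂ _,_ e f)) (Inverse.strictlyInverseʳ σ j)))

      distinct′ : ∀ {i j} → ¬ i ≡ j → q₂ i ≡ q₂ j → ¬ q₁ i ≡ q₁ j
      distinct′ i≢j f e = distinct i≢j e f

      -- Only two quadrants share a second sign, so no third vertex can have it.
      row : ∀ {i j k} → ¬ i ≡ j → ¬ i ≡ k → ¬ j ≡ k → q₂ i ≡ q₂ j → ¬ q₂ i ≡ q₂ k
      row i≢j i≢k j≢k e f =
        distinct′ j≢k (≡.trans (≡.sym e) f) (≢-≢⇒≡ (distinct′ i≢j e) (distinct′ i≢k f))

      column : ∀ {i j k} → ¬ i ≡ j → ¬ i ≡ k → ¬ j ≡ k → q₁ i ≡ q₁ j → ¬ q₁ i ≡ q₁ k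
      column i≢j i≢k j≢k e f =
        distinct j≢k (≡.trans (≡.sym e) f) (≢-≢⇒≡ (distinct i≢j e) (distinct i≢k f))

      same₁ : ∀ i → q₁ v₀₀ ≡ q₁ i → 0# ≤ signed (q₁ v₀₀) (ξ (vertex i))
      same₁ i e = ≡.subst (λ s → 0# ≤ signed s (ξ (vertex i))) (≡.sym e) (proj₁ (member i))

      same₂ : ∀ i → q₂ v₀₀ ≡ q₂ i → 0# ≤ signed (q₂ v₀₀) (η (vertex i))
      same₂ i e = ≡.subst (λ s → 0# ≤ signed s (η (vertex i))) (≡.sym e) (proj₂ (member i))

      other₁ : ∀ i → ¬ q₁ v₀₀ ≡ q₁ i → 0# ≤ - signed (q₁ v₀₀) (ξ (vertex i))
      other₁ i n = signed-≢ n (proj₁ (member i))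

      other₂ : ∀ i → ¬ q₂ v₀₀ ≡ q₂ i → 0# ≤ - signed (q₂ v₀₀) (η (vertex i))
      other₂ i n = signed-≢ n (proj₂ (member i))

      classify : ∃[ φ ] ∃[ A ] ∃[ g ] ∃[ h ] Corner φ A g h
      classify with q₂ v₀₀ Signₚ.≟ q₂ v₁₁ | q₁ v₀₀ Signₚ.≟ q₁ v₁₁
      ... | yes e | _ = ⊥-elim (opposite-vertices true (q₂ v₀₀) {base} {u} {v} basis
              (proj₂ (member v₀₀)) (same₂ v₁₁ e)
              (other₂ v₁₀ (row (λ ()) (λ ()) (λ ()) e))
              (other₂ v₀₁ (row (λ ()) (λ ()) (λ ()) e)))
      ... | no _ | yes e = ⊥-elim (opposite-vertices false (q₁ v₀₀) {base} {u} {v} basis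
              (proj₁ (member v₀₀)) (same₁ v₁₁ e)
              (other₁ v₁₀ (column (λ ()) (λ ()) (λ ()) e))
              (other₁ v₀₁ (column (λ ()) (λ ()) (λ ()) e)))
      -- The base and its opposite vertex are now in opposite quadrants, and the other two vertices
      -- fill the remaining ones in either order. Two negative answers mean that u and v have to be
      -- exchanged; mixed answers contradict injectivity.
      ... | no n₂ | no n₁ with q₂ v₀₀ Signₚ.≟ q₂ v₁₀ | q₁ v₀₀ Signₚ.≟ q₁ v₀₁
      ...   | yes e | yes f = _ , _ , _ , _ , base-corner (q₁ v₀₀) (q₂ v₀₀) base-lattice basis
              (member v₀₀)
              (other₁ v₁₀ (distinct′ (λ ()) e) , same₂ v₁₀ e)
              (same₁ v₀₁ f , other₂ v₀₁ (distinct (λ ()) f))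
              (other₁ v₁₁ n₁ , other₂ v₁₁ n₂)
      ...   | yes e | no n = ⊥-elim (distinct {v₀₁} {v₁₁} (λ ()) (≢-≢⇒≡ n n₁)
              (≢-≢⇒≡ (row (λ ()) (λ ()) (λ ()) e) n₂))
      ...   | no n | yes f = ⊥-elim (row {v₁₀} {v₁₁} {v₀₁} (λ ()) (λ ()) (λ ())
              (≢-≢⇒≡ n n₂) (≢-≢⇒≡ n (distinct (λ ()) f)))
      ...   | no n | no m = _ , _ , _ , _ ,
              base-corner (q₁ v₀₀) (q₂ v₀₀) base-lattice (basis-swap basis) (member v₀₀)
              (other₁ v₀₁ m , same₂ v₀₁ row₀₁)
              (same₁ v₁₀ column₁₀ , other₂ v₁₀ n)
              (0≤-cong (-‿cong (signed-cong (q₁ v₀₀) (exchange _ _ _))) (other₁ v₁₁ n₁) ,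
               0≤-cong (-‿cong (signed-cong (q₂ v₀₀) (exchange _ _ _))) (other₂ v₁₁ n₂))
        where
        exchange : ∀ x y z → x + y + z ≈ x + z + y
        exchange = solve 3 (λ x y z → x :+ y :+ z := x :+ z :+ y) refl

        row₀₁ : q₂ v₀₀ ≡ q₂ v₀₁
        row₀₁ with q₂ v₀₀ Signₚ.≟ q₂ v₀₁
        ... | yes e = e
        ... | no k  = ⊥-elim (row {v₁₀} {v₁₁} {v₀₁} (λ ()) (λ ()) (λ ()) (≢-≢⇒≡ n n₂) (≢-≢⇒≡ n k))

        column₁₀ : q₁ v₀₀ ≡ q₁ v₁₀
        column₁₀ with q₁ v₀₀ Signₚ.≟ q₁ v₁₀
        ... | yes e = e
        ... | no k  = ⊥-elim (distinct {v₁₀} {v₁₁} (λ ()) (≢-≢⇒≡ k n₁) (≢-≢⇒≡ n n₂))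

    -- From the given divided cell to the minimal point.

    locate : ∀ {φ A g h} → Corner φ A g h → ∀ P → IsLatticePoint P → ∃[ a ] ∃[ b ] Located P a b
    locate {i , s , t} {A} {g} {h} C P P-lattice =
      -- The coefficients of P - A are made nonnegative one after the other; the swap in between
      -- brings the first one into the place that `Corner-face` treats.
      let m , n , P-A≋ = spanning (P ⊖ A) (P , A , P-lattice , A-lattice , ≋-refl)
          t′ , A′ , h′ , b , C′ , P≋ , _ = Corner-face i s t m n C
            (by (proj₁ P-A≋) , by (proj₂ P-A≋))
          s′ , A″ , g′ , a , C″ , P≋′ , _ = Corner-face (not i) t′ s (+ b) m
            (Corner-swap (i , s , t′) C′) (position-swap A′ g h′ m (+ b) P≋)
      in b , a , (not i , t′ , s′) , A″ , h′ , g′ , C″ , P≋′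
      where
      open Corner C
      by : ∀ {p a x y} → p - a ≈ x + y → p ≈ a + x + y
      by {p} {a} {x} {y} e = trans (solve 2 (λ p a → p := a :+ (p :- a)) refl p a)
        (trans (+-congˡ e) (sym (+-assoc a x y)))

    Located⇒vertex : ∀ {P} → Empty P → ∃[ a ] ∃[ b ] Located P a b → IsVertexOfDividedCell P
    Located⇒vertex {P} empty (a , b , L) =
      at-corner (reach {P} empty a b (<-wellFounded (a ℕ.+ b)) L)
      where
      by : ∀ x y z → x + 0# * y + 0# * z ≈ x
      by = solve 3 (λ x y z → x :+ con (+ 0) :* y :+ con (+ 0) :* z := x) refl

      at-corner : Located P 0 0 → IsVertexOfDividedCell P
      at-corner (φ , A , g , h , C , P≋) =
        let cell , divided , i , A≋ = Corner⇒vertex φ C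
        in cell , divided , i , ≋-trans (≋-trans P≋ (by _ _ _ , by _ _ _)) A≋

    minimal⇒vertex : DividedCellsExist → ∀ P → IsLatticePoint P → IsMinimal P →
                     IsVertexOfDividedCell P
    minimal⇒vertex (cell , divided) P P-lattice minimal =
      let s , 0≤ξ = nonneg-sign (ξ P)
          t , 0≤η = nonneg-sign (η P)
          φ , A , g , h , C = IsDivided⇒Corner cell divided
      in Located⇒vertex {P} (Minimal.empty P-lattice minimal s t (0≤ξ , 0≤η))
           (locate {φ} {A} {g} {h} C P P-lattice)

theorem4 : ∀ {c ℓ₁ ℓ₂ : Level} (ℝ : RealField c ℓ₁ ℓ₂)
    (let open RealField ℝ)
    (a₀ b₀ c₀ a₁ b₁ c₁ : Carrier)
    (let open ViewingPlane ℝ a₀ b₀ c₀ a₁ b₁ c₁) →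
    ¬ (a₀ * b₁ - a₁ * b₀ ≈ 0#) →
    DividedCellsExist →
    ∀ (P : Point) → IsLatticePoint P → IsMinimal P →
    IsVertexOfDividedCell P
theorem4 ℝ a₀ b₀ c₀ a₁ b₁ c₁ det≉0 =
  Lattice.Nondegenerate.minimal⇒vertex ℝ a₀ b₀ c₀ a₁ b₁ c₁ det≉0
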